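{- If $\Delta;\Gamma\vdash t:A$ is derivable in $\lambda_{\mathrm{MELL}}$ and $t\to s$ ($\lambda_{\mathrm{MELL}}$-reduction), then $\Delta;\Gamma\vdash s:A$ is derivable.
   Context: MELL formulae: $A,B::=\alpha\mid\overline\alpha\mid A\otimes B\mid A\wp B\mid\mathbf 1\mid\bot\mid{!}A\mid{?}A$ ($\alpha$ atomic, $\overline\alpha$ its negative version, $\wp$ is "par"). Linear negation is the involution $\alpha^\perp=\overline\alpha$, $\overline\alpha^\perp=\alpha$, $(A\otimes B)^\perp=A^\perp\wp B^\perp$, $(A\wp B)^\perp=A^\perp\otimes B^\perp$, $\mathbf1^\perp=\bot$, $\bot^\perp=\mathbf1$, $({!}A)^\perp={?}(A^\perp)$, $({?}A)^\perp={!}(A^\perp)$. Terms of $\lambda_{\mathrm{MELL}}$, over linear variables $a,b,c,\dots$ and unrestricted variables $u,v,\dots$: $t,s::=a\mid u\mid\langle t,s\rangle\mid t[\langle a,b\rangle:=s]\mid\wp(a,b).t\mid t\bullet s\mid t\blacktriangledown s\mid{!}a.t\mid t[{!}u:=s]\mid{?}u.t\mid t\blacktriangleright^{a}s\mid t\,\sharp\,s\mid\star\mid t[\star:=s]$. Binding: $t[\langle a,b\rangle:=s]$ and $\wp(a,b).t$ bind $a,b$ in $t$; ${!}a.t$ and $t\blacktriangleright^a s$ bind $a$ in $t$; $t[{!}u:=s]$ and ${?}u.t$ bind $u$ in $t$. Terms are taken up to $\alpha$-renaming, and bound variables are always chosen to avoid capture. Typing judgements $\Delta;\Gamma\vdash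 t:A$, where $\Delta$ (resp. $\Gamma$) is a finite partial function from unrestricted (resp. linear) variables to formulae; $\Gamma,\Gamma'$ denotes union with disjoint domains. Typing rules (premises $\Rightarrow$ conclusion): $\Rightarrow\Delta;a:A\vdash a:A$; $\Rightarrow\Delta,u:A;\cdot\vdash u:A$; $\Delta;\Gamma\vdash t:A$ and $\Delta;\Gamma'\vdash s:B$ $\Rightarrow$ $\Delta;\Gamma,\Gamma'\vdash\langle t,s\rangle:A\otimes B$; $\Delta;\Gamma\vdash s:A\otimes B$ and $\Delta;\Gamma',a:A,b:B\vdash t:C$ $\Rightarrow$ $\Delta;\Gamma,\Gamma'\vdash t[\langle a,b\rangle:=s]:C$; $\Delta;\Gamma,a:A,b:B\vdash t:\bot$ $\Rightarrow$ $\Delta;\Gamma\vdash\wp(a,b).t:A^\perp\wp B^\perp$; $\Delta;\Gamma\vdash t:A\wp B$ and $\Delta;\Gamma'\vdash s:A^\perp$ $\Rightarrow$ $\Delta;\Gamma,\Gamma'\vdash t\bullet s:B$; $\Delta;\Gamma\vdash t:A\wp B$ and $\Delta;\Gamma'\vdash s:B^\perp$ $\Rightarrow$ $\Delta;\Gamma,\Gamma'\vdash t\blacktriangledown s:A$; $\Delta;a:A\vdash t:\bot$ $\Rightarrow$ $\Delta;\cdot\vdash{!}a.t:{!}(A^\perp)$; $\Delta;\Gamma\vdash s:{!}A$ and $\Delta,u:A;\Gamma'\vdash t:B$ $\Rightarrow$ $\Delta;\Gamma,\Gamma'\vdash t[{!}u:=s]:B$; $\Delta,u:A^\perp;\Gamma\vdash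 t:\bot$ $\Rightarrow$ $\Delta;\Gamma\vdash{?}u.t:{?}A$; $\Delta;\Gamma\vdash s:{?}A$ and $\Delta;a:A\vdash t:\bot$ $\Rightarrow$ $\Delta;\Gamma\vdash t\blacktriangleright^a s:\bot$; $\Delta;\Gamma\vdash t:B$ and $\Delta;\Gamma'\vdash s:B^\perp$ $\Rightarrow$ $\Delta;\Gamma,\Gamma'\vdash t\,\sharp\,s:\bot$; $\Rightarrow\Delta;\cdot\vdash\star:\mathbf1$; $\Delta;\Gamma\vdash s:\mathbf1$ and $\Delta;\Gamma'\vdash t:A$ $\Rightarrow$ $\Delta;\Gamma,\Gamma'\vdash t[\star:=s]:A$. A term is linear if: each free linear variable occurs exactly once; each bound linear variable occurs exactly once in the scope of its binder; subterms ${!}a.t$ have no free linear variables; in subterms $t\blacktriangleright^a s$ only $a$ occurs as a free linear variable in $t$. $t\{a:=s\}$, $t\{u:=s\}$ denote capture-avoiding substitution. For a linear term $t$ with $a\in\mathrm{fv}(t)$, the contra-substitution $t\{a\backslash\!\backslash s\}$ is defined by induction on $t$ (case "$i$" applies when $a\in\mathrm{fv}(t_i)$): $a\{a\backslash\!\backslash s\}=s$; $\langle t_1,t_2\rangle\{a\backslash\!\backslash s\}=t_1\{a\backslash\!\backslash s\blacktriangledown t_2\}$ (case 1), $t_2\{a\backslash\!\backslash s\bullet t_1\}$ (case 2); $(t_1\bullet t_2)\{a\backslash\!\backslash s\}=t_1\{a\backslash\!\backslash\langle t_2,s\rangle\}$ (1), $t_2\{a\backslash\!\backslash t_1\blacktriangledown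 s\}$ (2); $(t_1\blacktriangledown t_2)\{a\backslash\!\backslash s\}=t_1\{a\backslash\!\backslash\langle s,t_2\rangle\}$ (1), $t_2\{a\backslash\!\backslash t_1\bullet s\}$ (2); $(t_1[\langle b,c\rangle:=t_2])\{a\backslash\!\backslash s\}=(t_1\{a\backslash\!\backslash s\})[\langle b,c\rangle:=t_2]$ (1, $a\notin\{b,c\}$), $t_2\{a\backslash\!\backslash\wp(b,c).(t_1\sharp s)\}$ (2); $(\wp(b,c).t)\{a\backslash\!\backslash s\}=(t\{a\backslash\!\backslash\star\})[\langle b,c\rangle:=s]$; $(t_1[{!}u:=t_2])\{a\backslash\!\backslash s\}=(t_1\{a\backslash\!\backslash s\})[{!}u:=t_2]$ (1), $t_2\{a\backslash\!\backslash{?}u.(t_1\sharp s)\}$ (2); $({?}u.t)\{a\backslash\!\backslash s\}=(t\{a\backslash\!\backslash\star\})[{!}u:=s]$; $(t_1\blacktriangleright^b t_2)\{a\backslash\!\backslash s\}=(t_2\{a\backslash\!\backslash{!}b.t_1\})[\star:=s]$ (only case 2 is possible); $(t_1\sharp t_2)\{a\backslash\!\backslash s\}=(t_1\{a\backslash\!\backslash t_2\})[\star:=s]$ (1), $(t_2\{a\backslash\!\backslash t_1\})[\star:=s]$ (2); $(t_1[\star:=t_2])\{a\backslash\!\backslash s\}=(t_1\{a\backslash\!\backslash s\})[\star:=t_2]$ (1), $t_2\{a\backslash\!\backslash t_1\sharp s\}$ (2). (Terms ${!}b.t$ and $\star$ have no free linear variables, so no clause is needed.) Positive elimination contexts: $L,K::=\Box\mid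 L[\langle a,b\rangle:=t]\mid L[{!}u:=t]\mid L[\star:=t]$; $tL$ denotes filling the hole of $L$ with $t$ (free variables of $t$ may be captured by $L$). Pre-reduction $\to^-$ is the contextual closure (under all term constructors) of the following axioms, where both sides are assumed typed with the same type in the same contexts: $(\wp(a,b).t)L\bullet r\mapsto t\{a:=r\}\{b\backslash\!\backslash\star\}L$ ($b\notin\mathrm{fv}(r)$); $(\wp(a,b).t)L\blacktriangledown r\mapsto t\{b:=r\}\{a\backslash\!\backslash\star\}L$ ($a\notin\mathrm{fv}(r)$); $t[\langle a,b\rangle:=\langle s,r\rangle L]\mapsto t\{a:=s\}\{b:=r\}L$ ($b\notin\mathrm{fv}(s)$); $t[{!}u:=({!}a.s)L]\mapsto t\{u:=s\{a\backslash\!\backslash\star\}\}L$; $t\blacktriangleright^a({?}u.s)L\mapsto s\{u:=t\{a\backslash\!\backslash\star\}\}L$; $(\wp(a,b).t)L\,\sharp\,\langle s,r\rangle K\mapsto t\{a:=s\}\{b:=r\}LK$ ($b\notin\mathrm{fv}(s)$); $\langle s,r\rangle L\,\sharp\,(\wp(a,b).t)K\mapsto t\{a:=s\}\{b:=r\}LK$ ($b\notin\mathrm{fv}(s)$); $({!}a.t)L\,\sharp\,({?}u.r)K\mapsto r\{u:=t\{a\backslash\!\backslash\star\}\}LK$; $({?}u.r)L\,\sharp\,({!}a.t)K\mapsto r\{u:=t\{a\backslash\!\backslash\star\}\}LK$. Positive eliminators $[\langle a,b\rangle:=t]$, $[{!}u:=t]$, $[\star:=t]$ are written $[p:=t]$,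 with $\mathrm{fv}(\langle a,b\rangle)=\{a,b\}$, $\mathrm{fv}({!}u)=\{u\}$, $\mathrm{fv}(\star)=\emptyset$. Surface contexts $S$ are: $\wp(a,b).\Box$, $\langle\Box,t\rangle$, $\langle t,\Box\rangle$, $\Box\bullet t$, $t\bullet\Box$, $\Box\blacktriangledown t$, $t\blacktriangledown\Box$, $\Box\,\sharp\,t$, $t\,\sharp\,\Box$, ${?}u.\Box$, $\Box[p:=t]$, $t[p:=\Box]$, $t\blacktriangleright^a\Box$. A term $r$ is free for $S$ if $S\langle r\rangle$ does not bind free variables of $r$. Structural equivalence $\equiv$ is the reflexive, symmetric, transitive and contextual closure of the following axioms, where both sides are assumed typed with the same type in the same contexts: $S\langle t\rangle[p:=r]\equiv S\langle t[p:=r]\rangle$ if $\mathrm{fv}(p)\cap\mathrm{fv}(S)=\emptyset$ and $r$ is free for $S$; $t[\star:=\star]\equiv t$; $t[\star:=s]\equiv s[\star:=t]$; $t\{a\backslash\!\backslash\star\}\,\sharp\,r\equiv t\{a:=r\}$. $\lambda_{\mathrm{MELL}}$-reduction: $t\to s$ iff there exist $t',s'$ with $t\equiv t'\to^-s'\equiv s$. -}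

module Defs where

open import Data.Fin.Base using (Fin; zero; suc; lift; splitAt; punchIn; _↑ˡ_; _↑ʳ_)
open import Data.Maybe.Base using (Maybe; just; nothing)
open import Data.Nat.Base using (ℕ; suc; _+_)
open import Data.Product.Base using (_×_; ∃₂)
open import Data.Sum.Base using ([_,_]′)
open import Data.Vec.Base using (Vec; []; _∷_; lookup; replicate; _[_]≔_)
open import Data.Vec.Functional using (insertAt)
open import Function.Base using (id; _∘_)
open import Relation.Binary.Construct.Closure.Equivalence using (EqClosure)

private variable
  m n m′ n′ i j : ℕ

infix  30 _^⊥
infixr 25 _⊗_ _⅋_
infix  28 !_ ¿_

data Formula (X : Set) : Set where
  atom atom⁻ : X → Formula X
  _⊗_ _⅋_    : Formula X → Formula X → Formula X
  𝟏 ⊥        : Formula X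
  !_ ¿_      : Formula X → Formula X

_^⊥ : {X : Set} → Formula X → Formula X
(atom α) ^⊥  = atom⁻ α
(atom⁻ α) ^⊥ = atom α
(A ⊗ B) ^⊥   = A ^⊥ ⅋ B ^⊥
(A ⅋ B) ^⊥   = A ^⊥ ⊗ B ^⊥
𝟏 ^⊥         = ⊥
⊥ ^⊥         = 𝟏
(! A) ^⊥     = ¿ (A ^⊥)
(¿ A) ^⊥     = ! (A ^⊥)

-- Terms up to α-renaming, as de Bruijn terms: Term m n has m unrestricted and
-- n linear variables in scope (in scope, not necessarily used). A binder of a
-- pair a,b gives index 0 to a and index 1 to b.

infixl 20 _•_ _▾_ _[⟨⟩≔_] _[!≔_] _[⋆≔_]
infix  18 _▸_ _♯_
infix  19 ⅋·_ !·_ ?·_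

data Term (m n : ℕ) : Set where
  lvar     : Fin n → Term m n
  uvar     : Fin m → Term m n
  ⟨_,_⟩    : Term m n → Term m n → Term m n
  _[⟨⟩≔_]  : Term m (2 + n) → Term m n → Term m n
  ⅋·_      : Term m (2 + n) → Term m n
  _•_ _▾_  : Term m n → Term m n → Term m n
  !·_      : Term m (1 + n) → Term m n
  _[!≔_]   : Term (1 + m) n → Term m n → Term m n
  ?·_      : Term (1 + m) n → Term m n
  _▸_      : Term m (1 + n) → Term m n → Term m n
  _♯_      : Term m n → Term m n → Term m n
  ⋆        : Term m n
  _[⋆≔_]   : Term m n → Term m n → Term m n

ren : (Fin m → Fin m′) → (Fin n → Fin n′) → Term m n → Term m′ n′
ren ρ τ (lvar a)      = lvar (τ a)
ren ρ τ (uvar u)      = uvar (ρ u)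
ren ρ τ ⟨ t , s ⟩     = ⟨ ren ρ τ t , ren ρ τ s ⟩
ren ρ τ (t [⟨⟩≔ s ])  = ren ρ (lift 2 τ) t [⟨⟩≔ ren ρ τ s ]
ren ρ τ (⅋· t)        = ⅋· ren ρ (lift 2 τ) t
ren ρ τ (t • s)       = ren ρ τ t • ren ρ τ s
ren ρ τ (t ▾ s)       = ren ρ τ t ▾ ren ρ τ s
ren ρ τ (!· t)        = !· ren ρ (lift 1 τ) t
ren ρ τ (t [!≔ s ])   = ren (lift 1 ρ) τ t [!≔ ren ρ τ s ]
ren ρ τ (?· t)        = ?· ren (lift 1 ρ) τ t
ren ρ τ (t ▸ s)       = ren ρ (lift 1 τ) t ▸ ren ρ τ s
ren ρ τ (t ♯ s)       = ren ρ τ t ♯ ren ρ τ s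
ren ρ τ ⋆             = ⋆
ren ρ τ (t [⋆≔ s ])   = ren ρ τ t [⋆≔ ren ρ τ s ]

wk : ∀ i j {m n} → Term m n → Term (i + m) (j + n)
wk i j = ren (i ↑ʳ_) (j ↑ʳ_)

-- A term in which the linear variable a does not occur is one of the form
-- thin a t.
thin : Fin (suc n) → Term m n → Term m (suc n)
thin a = ren id (punchIn a)

infix 22 _⟪_≔_⟫ₗ _⟪_≔_⟫ᵤ

_⟪_≔_⟫ₗ : Term m (suc n) → Fin (suc n) → Term m n → Term m n
(lvar b) ⟪ a ≔ r ⟫ₗ      = insertAt lvar a r b
(uvar u) ⟪ a ≔ r ⟫ₗ      = uvar u
⟨ t , s ⟩ ⟪ a ≔ r ⟫ₗ     = ⟨ t ⟪ a ≔ r ⟫ₗ , s ⟪ a ≔ r ⟫ₗ ⟩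
(t [⟨⟩≔ s ]) ⟪ a ≔ r ⟫ₗ  = t ⟪ suc (suc a) ≔ wk 0 2 r ⟫ₗ [⟨⟩≔ s ⟪ a ≔ r ⟫ₗ ]
(⅋· t) ⟪ a ≔ r ⟫ₗ        = ⅋· t ⟪ suc (suc a) ≔ wk 0 2 r ⟫ₗ
(t • s) ⟪ a ≔ r ⟫ₗ       = t ⟪ a ≔ r ⟫ₗ • s ⟪ a ≔ r ⟫ₗ
(t ▾ s) ⟪ a ≔ r ⟫ₗ       = t ⟪ a ≔ r ⟫ₗ ▾ s ⟪ a ≔ r ⟫ₗ
(!· t) ⟪ a ≔ r ⟫ₗ        = !· t ⟪ suc a ≔ wk 0 1 r ⟫ₗ
(t [!≔ s ]) ⟪ a ≔ r ⟫ₗ   = t ⟪ a ≔ wk 1 0 r ⟫ₗ [!≔ s ⟪ a ≔ r ⟫ₗ ]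
(?· t) ⟪ a ≔ r ⟫ₗ        = ?· t ⟪ a ≔ wk 1 0 r ⟫ₗ
(t ▸ s) ⟪ a ≔ r ⟫ₗ       = t ⟪ suc a ≔ wk 0 1 r ⟫ₗ ▸ s ⟪ a ≔ r ⟫ₗ
(t ♯ s) ⟪ a ≔ r ⟫ₗ       = t ⟪ a ≔ r ⟫ₗ ♯ s ⟪ a ≔ r ⟫ₗ
⋆ ⟪ a ≔ r ⟫ₗ             = ⋆
(t [⋆≔ s ]) ⟪ a ≔ r ⟫ₗ   = t ⟪ a ≔ r ⟫ₗ [⋆≔ s ⟪ a ≔ r ⟫ₗ ]

_⟪_≔_⟫ᵤ : Term (suc m) n → Fin (suc m) → Term m n → Term m n
(lvar a) ⟪ u ≔ r ⟫ᵤ      = lvar a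
(uvar v) ⟪ u ≔ r ⟫ᵤ      = insertAt uvar u r v
⟨ t , s ⟩ ⟪ u ≔ r ⟫ᵤ     = ⟨ t ⟪ u ≔ r ⟫ᵤ , s ⟪ u ≔ r ⟫ᵤ ⟩
(t [⟨⟩≔ s ]) ⟪ u ≔ r ⟫ᵤ  = t ⟪ u ≔ wk 0 2 r ⟫ᵤ [⟨⟩≔ s ⟪ u ≔ r ⟫ᵤ ]
(⅋· t) ⟪ u ≔ r ⟫ᵤ        = ⅋· t ⟪ u ≔ wk 0 2 r ⟫ᵤ
(t • s) ⟪ u ≔ r ⟫ᵤ       = t ⟪ u ≔ r ⟫ᵤ • s ⟪ u ≔ r ⟫ᵤ
(t ▾ s) ⟪ u ≔ r ⟫ᵤ       = t ⟪ u ≔ r ⟫ᵤ ▾ s ⟪ u ≔ r ⟫ᵤ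
(!· t) ⟪ u ≔ r ⟫ᵤ        = !· t ⟪ u ≔ wk 0 1 r ⟫ᵤ
(t [!≔ s ]) ⟪ u ≔ r ⟫ᵤ   = t ⟪ suc u ≔ wk 1 0 r ⟫ᵤ [!≔ s ⟪ u ≔ r ⟫ᵤ ]
(?· t) ⟪ u ≔ r ⟫ᵤ        = ?· t ⟪ suc u ≔ wk 1 0 r ⟫ᵤ
(t ▸ s) ⟪ u ≔ r ⟫ᵤ       = t ⟪ u ≔ wk 0 1 r ⟫ᵤ ▸ s ⟪ u ≔ r ⟫ᵤ
(t ♯ s) ⟪ u ≔ r ⟫ᵤ       = t ⟪ u ≔ r ⟫ᵤ ♯ s ⟪ u ≔ r ⟫ᵤ
⋆ ⟪ u ≔ r ⟫ᵤ             = ⋆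
(t [⋆≔ s ]) ⟪ u ≔ r ⟫ᵤ   = t ⟪ u ≔ r ⟫ᵤ [⋆≔ s ⟪ u ≔ r ⟫ᵤ ]

-- Contra-substitution is a partial function, given here by its graph:
-- t ⟪ a ∖∖ s ⟫≔ r  reads  t{a\\s} = r. The clauses for binary constructors are
-- selected by which subterm contains a; that the other subterm does not is
-- expressed by thin. On a linear term t, some r exists iff a is free in t, and
-- it is then unique.

infix 15 _⟪_∖∖_⟫≔_

data _⟪_∖∖_⟫≔_ : ∀ {m n} → Term m (suc n) → Fin (suc n) → Term m n → Term m n → Set where
  var   : ∀ {a} {s : Term m n} →
          lvar a ⟪ a ∖∖ s ⟫≔ s
  pair₁ : ∀ {a t₁} {t₂ s r : Term m n} →
          t₁ ⟪ a ∖∖ s ▾ t₂ ⟫≔ r →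
          ⟨ t₁ , thin a t₂ ⟩ ⟪ a ∖∖ s ⟫≔ r
  pair₂ : ∀ {a t₂} {t₁ s r : Term m n} →
          t₂ ⟪ a ∖∖ s • t₁ ⟫≔ r →
          ⟨ thin a t₁ , t₂ ⟩ ⟪ a ∖∖ s ⟫≔ r
  app•₁ : ∀ {a t₁} {t₂ s r : Term m n} →
          t₁ ⟪ a ∖∖ ⟨ t₂ , s ⟩ ⟫≔ r →
          t₁ • thin a t₂ ⟪ a ∖∖ s ⟫≔ r
  app•₂ : ∀ {a t₂} {t₁ s r : Term m n} →
          t₂ ⟪ a ∖∖ t₁ ▾ s ⟫≔ r →
          thin a t₁ • t₂ ⟪ a ∖∖ s ⟫≔ r
  app▾₁ : ∀ {a t₁} {t₂ s r : Term m n} →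
          t₁ ⟪ a ∖∖ ⟨ s , t₂ ⟩ ⟫≔ r →
          t₁ ▾ thin a t₂ ⟪ a ∖∖ s ⟫≔ r
  app▾₂ : ∀ {a t₂} {t₁ s r : Term m n} →
          t₂ ⟪ a ∖∖ t₁ • s ⟫≔ r →
          thin a t₁ ▾ t₂ ⟪ a ∖∖ s ⟫≔ r
  let⊗₁ : ∀ {a t₁} {t₂ s : Term m n} {r} →
          t₁ ⟪ suc (suc a) ∖∖ wk 0 2 s ⟫≔ r →
          t₁ [⟨⟩≔ thin a t₂ ] ⟪ a ∖∖ s ⟫≔ r [⟨⟩≔ t₂ ]
  let⊗₂ : ∀ {a t₁ t₂} {s r : Term m n} →
          t₂ ⟪ a ∖∖ ⅋· (t₁ ♯ wk 0 2 s) ⟫≔ r →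
          thin (suc (suc a)) t₁ [⟨⟩≔ t₂ ] ⟪ a ∖∖ s ⟫≔ r
  par   : ∀ {a t} {s : Term m n} {r} →
          t ⟪ suc (suc a) ∖∖ ⋆ ⟫≔ r →
          ⅋· t ⟪ a ∖∖ s ⟫≔ r [⟨⟩≔ s ]
  let!₁ : ∀ {a t₁} {t₂ s : Term m n} {r} →
          t₁ ⟪ a ∖∖ wk 1 0 s ⟫≔ r →
          t₁ [!≔ thin a t₂ ] ⟪ a ∖∖ s ⟫≔ r [!≔ t₂ ]
  let!₂ : ∀ {a t₁ t₂} {s r : Term m n} →
          t₂ ⟪ a ∖∖ ?· (t₁ ♯ wk 1 0 s) ⟫≔ r →
          thin a t₁ [!≔ t₂ ] ⟪ a ∖∖ s ⟫≔ r
  whyn  : ∀ {a t} {s : Term m n} {r} →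
          t ⟪ a ∖∖ ⋆ ⟫≔ r →
          ?· t ⟪ a ∖∖ s ⟫≔ r [!≔ s ]
  ask₂  : ∀ {a t₁ t₂} {s r : Term m n} →
          t₂ ⟪ a ∖∖ !· t₁ ⟫≔ r →
          thin (suc a) t₁ ▸ t₂ ⟪ a ∖∖ s ⟫≔ r [⋆≔ s ]
  cut₁  : ∀ {a t₁} {t₂ s r : Term m n} →
          t₁ ⟪ a ∖∖ t₂ ⟫≔ r →
          t₁ ♯ thin a t₂ ⟪ a ∖∖ s ⟫≔ r [⋆≔ s ]
  cut₂  : ∀ {a t₂} {t₁ s r : Term m n} →
          t₂ ⟪ a ∖∖ t₁ ⟫≔ r →
          thin a t₁ ♯ t₂ ⟪ a ∖∖ s ⟫≔ r [⋆≔ s ]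
  let⋆₁ : ∀ {a t₁} {t₂ s r : Term m n} →
          t₁ ⟪ a ∖∖ s ⟫≔ r →
          t₁ [⋆≔ thin a t₂ ] ⟪ a ∖∖ s ⟫≔ r [⋆≔ t₂ ]
  let⋆₂ : ∀ {a t₂} {t₁ s r : Term m n} →
          t₂ ⟪ a ∖∖ t₁ ♯ s ⟫≔ r →
          thin a t₁ [⋆≔ t₂ ] ⟪ a ∖∖ s ⟫≔ r

-- Linear contexts are partial functions on the linear variables in scope;
-- Γ₁ ⊎ Γ₂ ≔ Γ says that Γ₁ and Γ₂ have disjoint domains and union Γ.
-- Unrestricted contexts may be taken total on the unrestricted scope.

UCtx LCtx : Set → ℕ → Set
UCtx X m = Vec (Formula X) m
LCtx X n = Vec (Maybe (Formula X)) n

∅ : ∀ {X n} → LCtx X n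
∅ = replicate _ nothing

infix 4 _⊎_≔_

data _⊎_≔_ {X : Set} : ∀ {n} → LCtx X n → LCtx X n → LCtx X n → Set where
  []    : [] ⊎ [] ≔ []
  none  : {Γ₁ Γ₂ Γ : LCtx X n} → Γ₁ ⊎ Γ₂ ≔ Γ →
          nothing ∷ Γ₁ ⊎ nothing ∷ Γ₂ ≔ nothing ∷ Γ
  left  : ∀ {A} {Γ₁ Γ₂ Γ : LCtx X n} → Γ₁ ⊎ Γ₂ ≔ Γ →
          just A ∷ Γ₁ ⊎ nothing ∷ Γ₂ ≔ just A ∷ Γ
  right : ∀ {A} {Γ₁ Γ₂ Γ : LCtx X n} → Γ₁ ⊎ Γ₂ ≔ Γ →
          nothing ∷ Γ₁ ⊎ just A ∷ Γ₂ ≔ just A ∷ Γ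

infix 4 _⨾_⊢_∶_

data _⨾_⊢_∶_ {X : Set} : ∀ {m n} → UCtx X m → LCtx X n → Term m n → Formula X → Set where
  ax   : ∀ {A} {Δ : UCtx X m} (a : Fin n) →
         Δ ⨾ ∅ [ a ]≔ just A ⊢ lvar a ∶ A
  uax  : {Δ : UCtx X m} (u : Fin m) →
         Δ ⨾ ∅ {n = n} ⊢ uvar u ∶ lookup Δ u
  ⊗I   : ∀ {A B t s} {Δ : UCtx X m} {Γ Γ′ Γ″ : LCtx X n} →
         Γ ⊎ Γ′ ≔ Γ″ →
         Δ ⨾ Γ ⊢ t ∶ A → Δ ⨾ Γ′ ⊢ s ∶ B →
         Δ ⨾ Γ″ ⊢ ⟨ t , s ⟩ ∶ A ⊗ B
  ⊗E   : ∀ {A B C t s} {Δ : UCtx X m} {Γ Γ′ Γ″ : LCtx X n} →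
         Γ ⊎ Γ′ ≔ Γ″ →
         Δ ⨾ Γ ⊢ s ∶ A ⊗ B → Δ ⨾ just A ∷ just B ∷ Γ′ ⊢ t ∶ C →
         Δ ⨾ Γ″ ⊢ t [⟨⟩≔ s ] ∶ C
  ⅋I   : ∀ {A B t} {Δ : UCtx X m} {Γ : LCtx X n} →
         Δ ⨾ just A ∷ just B ∷ Γ ⊢ t ∶ ⊥ →
         Δ ⨾ Γ ⊢ ⅋· t ∶ A ^⊥ ⅋ B ^⊥
  ⅋E•  : ∀ {A B t s} {Δ : UCtx X m} {Γ Γ′ Γ″ : LCtx X n} →
         Γ ⊎ Γ′ ≔ Γ″ →
         Δ ⨾ Γ ⊢ t ∶ A ⅋ B → Δ ⨾ Γ′ ⊢ s ∶ A ^⊥ →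
         Δ ⨾ Γ″ ⊢ t • s ∶ B
  ⅋E▾  : ∀ {A B t s} {Δ : UCtx X m} {Γ Γ′ Γ″ : LCtx X n} →
         Γ ⊎ Γ′ ≔ Γ″ →
         Δ ⨾ Γ ⊢ t ∶ A ⅋ B → Δ ⨾ Γ′ ⊢ s ∶ B ^⊥ →
         Δ ⨾ Γ″ ⊢ t ▾ s ∶ A
  !I   : ∀ {A t} {Δ : UCtx X m} →
         Δ ⨾ just A ∷ ∅ {n = n} ⊢ t ∶ ⊥ →
         Δ ⨾ ∅ {n = n} ⊢ !· t ∶ ! (A ^⊥)
  !E   : ∀ {A B t s} {Δ : UCtx X m} {Γ Γ′ Γ″ : LCtx X n} →
         Γ ⊎ Γ′ ≔ Γ″ →
         Δ ⨾ Γ ⊢ s ∶ ! A → A ∷ Δ ⨾ Γ′ ⊢ t ∶ B →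
         Δ ⨾ Γ″ ⊢ t [!≔ s ] ∶ B
  ?I   : ∀ {A t} {Δ : UCtx X m} {Γ : LCtx X n} →
         A ^⊥ ∷ Δ ⨾ Γ ⊢ t ∶ ⊥ →
         Δ ⨾ Γ ⊢ ?· t ∶ ¿ A
  ?E   : ∀ {A t s} {Δ : UCtx X m} {Γ : LCtx X n} →
         Δ ⨾ Γ ⊢ s ∶ ¿ A → Δ ⨾ just A ∷ ∅ ⊢ t ∶ ⊥ →
         Δ ⨾ Γ ⊢ t ▸ s ∶ ⊥
  cut  : ∀ {B t s} {Δ : UCtx X m} {Γ Γ′ Γ″ : LCtx X n} →
         Γ ⊎ Γ′ ≔ Γ″ →
         Δ ⨾ Γ ⊢ t ∶ B → Δ ⨾ Γ′ ⊢ s ∶ B ^⊥ →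
         Δ ⨾ Γ″ ⊢ t ♯ s ∶ ⊥
  𝟏I   : {Δ : UCtx X m} →
         Δ ⨾ ∅ {n = n} ⊢ ⋆ ∶ 𝟏
  𝟏E   : ∀ {A t s} {Δ : UCtx X m} {Γ Γ′ Γ″ : LCtx X n} →
         Γ ⊎ Γ′ ≔ Γ″ →
         Δ ⨾ Γ ⊢ s ∶ 𝟏 → Δ ⨾ Γ′ ⊢ t ∶ A →
         Δ ⨾ Γ″ ⊢ t [⋆≔ s ] ∶ A

-- Positive elimination contexts, where PCtx m n i j has scope m, n outside and
-- binds i unrestricted and j linear variables at its hole. They are built by
-- adding eliminators at the hole rather than at the outside.

infixl 20 _▹[⟨⟩≔_] _▹[!≔_] _▹[⋆≔_]

data PCtx (m n : ℕ) : ℕ → ℕ → Set where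
  □         : PCtx m n 0 0
  _▹[⟨⟩≔_]  : PCtx m n i j → Term (i + m) (j + n) → PCtx m n i (2 + j)
  _▹[!≔_]   : PCtx m n i j → Term (i + m) (j + n) → PCtx m n (1 + i) j
  _▹[⋆≔_]   : PCtx m n i j → Term (i + m) (j + n) → PCtx m n i j

infix 21 _⟦_⟧ _⟪_⟫ₛ

_⟦_⟧ : PCtx m n i j → Term (i + m) (j + n) → Term m n
□ ⟦ t ⟧               = t
(L ▹[⟨⟩≔ s ]) ⟦ t ⟧   = L ⟦ t [⟨⟩≔ s ] ⟧
(L ▹[!≔ s ]) ⟦ t ⟧    = L ⟦ t [!≔ s ] ⟧
(L ▹[⋆≔ s ]) ⟦ t ⟧    = L ⟦ t [⋆≔ s ] ⟧

renᴾ : (Fin m → Fin m′) → (Fin n → Fin n′) → PCtx m n i j → PCtx m′ n′ i j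
renᴾ ρ τ □                                = □
renᴾ ρ τ (_▹[⟨⟩≔_] {i = i} {j = j} L s)   = renᴾ ρ τ L ▹[⟨⟩≔ ren (lift i ρ) (lift j τ) s ]
renᴾ ρ τ (_▹[!≔_] {i = i} {j = j} L s)    = renᴾ ρ τ L ▹[!≔ ren (lift i ρ) (lift j τ) s ]
renᴾ ρ τ (_▹[⋆≔_] {i = i} {j = j} L s)    = renᴾ ρ τ L ▹[⋆≔ ren (lift i ρ) (lift j τ) s ]

wkᴾ : ∀ k l {m n i j} → PCtx m n i j → PCtx (k + m) (l + n) i j
wkᴾ k l = renᴾ (k ↑ʳ_) (l ↑ʳ_)

-- Weakens by k unrestricted and l linear variables, below i and j binders. In
-- tLK it moves the contents of L, along with L itself, into the hole of K.
wkUnder : ∀ i j k l {m n} → Term (i + m) (j + n) → Term (i + (k + m)) (j + (l + n))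
wkUnder i j k l = ren (lift i (k ↑ʳ_)) (lift j (l ↑ʳ_))

-- Pre-reduction is defined on raw terms. That both sides of an axiom be typed
-- alike is not imposed: for a typed redex it is a consequence, which subject
-- reduction must establish. Conditions such as b ∉ fv(r) hold because r is
-- weakened into the scope of b.

infix 4 _↦_ _⟶⁻_

data _↦_ {m n : ℕ} : Term m n → Term m n → Set where
  ⅋• : ∀ {i j} (L : PCtx m n i j) {t r t′} →
       t ⟪ zero ≔ wk 0 1 (wk i j r) ⟫ₗ ⟪ zero ∖∖ ⋆ ⟫≔ t′ →
       L ⟦ ⅋· t ⟧ • r ↦ L ⟦ t′ ⟧
  ⅋▾ : ∀ {i j} (L : PCtx m n i j) {t r t′} →
       t ⟪ suc zero ≔ wk 0 1 (wk i j r) ⟫ₗ ⟪ zero ∖∖ ⋆ ⟫≔ t′ →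
       L ⟦ ⅋· t ⟧ ▾ r ↦ L ⟦ t′ ⟧
  ⊗⊗ : ∀ {i j} (L : PCtx m n i j) {t s r} →
       t [⟨⟩≔ L ⟦ ⟨ s , r ⟩ ⟧ ]
         ↦ L ⟦ wkUnder 0 2 i j t ⟪ zero ≔ wk 0 1 s ⟫ₗ ⟪ zero ≔ r ⟫ₗ ⟧
  !! : ∀ {i j} (L : PCtx m n i j) {t s s′} →
       s ⟪ zero ∖∖ ⋆ ⟫≔ s′ →
       t [!≔ L ⟦ !· s ⟧ ] ↦ L ⟦ wkUnder 1 0 i j t ⟪ zero ≔ s′ ⟫ᵤ ⟧
  ?? : ∀ {i j} (L : PCtx m n i j) {t t′ s} →
       t ⟪ zero ∖∖ ⋆ ⟫≔ t′ →
       t ▸ L ⟦ ?· s ⟧ ↦ L ⟦ s ⟪ zero ≔ wk i j t′ ⟫ᵤ ⟧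
  ⅋⊗ : ∀ {i j k l} (L : PCtx m n i j) (K : PCtx m n k l) {t s r} →
       L ⟦ ⅋· t ⟧ ♯ K ⟦ ⟨ s , r ⟩ ⟧
         ↦ K ⟦ wkᴾ k l L ⟦ wkUnder i (2 + j) k l t ⟪ zero ≔ wk 0 1 (wk i j s) ⟫ₗ
                                                  ⟪ zero ≔ wk i j r ⟫ₗ ⟧ ⟧
  ⊗⅋ : ∀ {i j k l} (L : PCtx m n i j) (K : PCtx m n k l) {t s r} →
       L ⟦ ⟨ s , r ⟩ ⟧ ♯ K ⟦ ⅋· t ⟧
         ↦ K ⟦ wkᴾ k l L ⟦ wkUnder 0 2 i j t ⟪ zero ≔ wk 0 1 (wkUnder i j k l s) ⟫ₗ
                                            ⟪ zero ≔ wkUnder i j k l r ⟫ₗ ⟧ ⟧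
  !? : ∀ {i j k l} (L : PCtx m n i j) (K : PCtx m n k l) {t t′ r} →
       t ⟪ zero ∖∖ ⋆ ⟫≔ t′ →
       L ⟦ !· t ⟧ ♯ K ⟦ ?· r ⟧
         ↦ K ⟦ wkᴾ k l L ⟦ wkUnder 1 0 i j r ⟪ zero ≔ wkUnder i j k l t′ ⟫ᵤ ⟧ ⟧
  ?! : ∀ {i j k l} (L : PCtx m n i j) (K : PCtx m n k l) {t t′ r} →
       t ⟪ zero ∖∖ ⋆ ⟫≔ t′ →
       L ⟦ ?· r ⟧ ♯ K ⟦ !· t ⟧
         ↦ K ⟦ wkᴾ k l L ⟦ wkUnder (1 + i) j k l r ⟪ zero ≔ wk i j t′ ⟫ᵤ ⟧ ⟧

data _⟶⁻_ : ∀ {m n} → Term m n → Term m n → Set where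
  ax    : {t t′ : Term m n} →
          t ↦ t′ → t ⟶⁻ t′
  pair₁ : {t t′ s : Term m n} →
          t ⟶⁻ t′ → ⟨ t , s ⟩ ⟶⁻ ⟨ t′ , s ⟩
  pair₂ : {t s s′ : Term m n} →
          s ⟶⁻ s′ → ⟨ t , s ⟩ ⟶⁻ ⟨ t , s′ ⟩
  let⊗₁ : {t t′ : Term m (2 + n)} {s : Term m n} →
          t ⟶⁻ t′ → t [⟨⟩≔ s ] ⟶⁻ t′ [⟨⟩≔ s ]
  let⊗₂ : {t : Term m (2 + n)} {s s′ : Term m n} →
          s ⟶⁻ s′ → t [⟨⟩≔ s ] ⟶⁻ t [⟨⟩≔ s′ ]
  par   : {t t′ : Term m (2 + n)} →
          t ⟶⁻ t′ → ⅋· t ⟶⁻ ⅋· t′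
  app•₁ : {t t′ s : Term m n} →
          t ⟶⁻ t′ → t • s ⟶⁻ t′ • s
  app•₂ : {t s s′ : Term m n} →
          s ⟶⁻ s′ → t • s ⟶⁻ t • s′
  app▾₁ : {t t′ s : Term m n} →
          t ⟶⁻ t′ → t ▾ s ⟶⁻ t′ ▾ s
  app▾₂ : {t s s′ : Term m n} →
          s ⟶⁻ s′ → t ▾ s ⟶⁻ t ▾ s′
  bang  : {t t′ : Term m (1 + n)} →
          t ⟶⁻ t′ → !· t ⟶⁻ !· t′
  let!₁ : {t t′ : Term (1 + m) n} {s : Term m n} →
          t ⟶⁻ t′ → t [!≔ s ] ⟶⁻ t′ [!≔ s ]
  let!₂ : {t : Term (1 + m) n} {s s′ : Term m n} →
          s ⟶⁻ s′ → t [!≔ s ] ⟶⁻ t [!≔ s′ ]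
  whyn  : {t t′ : Term (1 + m) n} →
          t ⟶⁻ t′ → ?· t ⟶⁻ ?· t′
  ask₁  : {t t′ : Term m (1 + n)} {s : Term m n} →
          t ⟶⁻ t′ → t ▸ s ⟶⁻ t′ ▸ s
  ask₂  : {t : Term m (1 + n)} {s s′ : Term m n} →
          s ⟶⁻ s′ → t ▸ s ⟶⁻ t ▸ s′
  cut₁  : {t t′ s : Term m n} →
          t ⟶⁻ t′ → t ♯ s ⟶⁻ t′ ♯ s
  cut₂  : {t s s′ : Term m n} →
          s ⟶⁻ s′ → t ♯ s ⟶⁻ t ♯ s′
  let⋆₁ : {t t′ s : Term m n} →
          t ⟶⁻ t′ → t [⋆≔ s ] ⟶⁻ t′ [⋆≔ s ]
  let⋆₂ : {t s s′ : Term m n} →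
          s ⟶⁻ s′ → t [⋆≔ s ] ⟶⁻ t [⋆≔ s′ ]

-- The three kinds of positive eliminator, with the numbers of unrestricted and
-- linear variables they bind.

data Pat : Set where
  ⟨⟩ᵖ !ᵖ ⋆ᵖ : Pat

uvs lvs : Pat → ℕ
uvs ⟨⟩ᵖ = 0
uvs !ᵖ  = 1
uvs ⋆ᵖ  = 0
lvs ⟨⟩ᵖ = 2
lvs !ᵖ  = 0
lvs ⋆ᵖ  = 0

elim : ∀ {m n} (p : Pat) → Term (uvs p + m) (lvs p + n) → Term m n → Term m n
elim ⟨⟩ᵖ t s = t [⟨⟩≔ s ]
elim !ᵖ  t s = t [!≔ s ]
elim ⋆ᵖ  t s = t [⋆≔ s ]

data SCtx (m n : ℕ) : ℕ → ℕ → Set where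
  par         : SCtx m n 0 2
  pair₁ pair₂ : Term m n → SCtx m n 0 0
  app•₁ app•₂ : Term m n → SCtx m n 0 0
  app▾₁ app▾₂ : Term m n → SCtx m n 0 0
  cut₁ cut₂   : Term m n → SCtx m n 0 0
  whyn        : SCtx m n 1 0
  elim₁       : (p : Pat) → Term m n → SCtx m n (uvs p) (lvs p)
  elim₂       : (p : Pat) → Term (uvs p + m) (lvs p + n) → SCtx m n 0 0
  ask₂        : Term m (1 + n) → SCtx m n 0 0

_⟪_⟫ₛ : SCtx m n i j → Term (i + m) (j + n) → Term m n
par ⟪ t ⟫ₛ          = ⅋· t
pair₁ s ⟪ t ⟫ₛ      = ⟨ t , s ⟩
pair₂ s ⟪ t ⟫ₛ      = ⟨ s , t ⟩
app•₁ s ⟪ t ⟫ₛ      = t • s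
app•₂ s ⟪ t ⟫ₛ      = s • t
app▾₁ s ⟪ t ⟫ₛ      = t ▾ s
app▾₂ s ⟪ t ⟫ₛ      = s ▾ t
cut₁ s ⟪ t ⟫ₛ       = t ♯ s
cut₂ s ⟪ t ⟫ₛ       = s ♯ t
whyn ⟪ t ⟫ₛ         = ?· t
elim₁ p s ⟪ t ⟫ₛ    = elim p t s
elim₂ p s ⟪ t ⟫ₛ    = elim p s t
ask₂ s ⟪ t ⟫ₛ       = s ▸ t

renˢ : (Fin m → Fin m′) → (Fin n → Fin n′) → SCtx m n i j → SCtx m′ n′ i j
renˢ ρ τ par         = par
renˢ ρ τ (pair₁ s)   = pair₁ (ren ρ τ s)
renˢ ρ τ (pair₂ s)   = pair₂ (ren ρ τ s)
renˢ ρ τ (app•₁ s)   = app•₁ (ren ρ τ s)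
renˢ ρ τ (app•₂ s)   = app•₂ (ren ρ τ s)
renˢ ρ τ (app▾₁ s)   = app▾₁ (ren ρ τ s)
renˢ ρ τ (app▾₂ s)   = app▾₂ (ren ρ τ s)
renˢ ρ τ (cut₁ s)    = cut₁ (ren ρ τ s)
renˢ ρ τ (cut₂ s)    = cut₂ (ren ρ τ s)
renˢ ρ τ whyn        = whyn
renˢ ρ τ (elim₁ p s) = elim₁ p (ren ρ τ s)
renˢ ρ τ (elim₂ p s) = elim₂ p (ren (lift (uvs p) ρ) (lift (lvs p) τ) s)
renˢ ρ τ (ask₂ s)    = ask₂ (ren ρ (lift 1 τ) s)

-- Exchanges an inner block of k binders with the block of i binders around it.
exch : ∀ k i {m} → Fin (k + (i + m)) → Fin (i + (k + m))
exch k i {m} = [ (λ x → i ↑ʳ (x ↑ˡ m)) , [ _↑ˡ (k + m) , (λ z → i ↑ʳ (k ↑ʳ z)) ]′ ∘ splitAt i ]′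
               ∘ splitAt k

-- Axioms of structural equivalence. In comm, the side conditions
-- fv(p) ∩ fv(S) = ∅ and "r is free for S" hold because S and r are weakened into
-- the scope of the binders of p and of S respectively.

infix 4 _≈_

data _≈_ {m n : ℕ} : Term m n → Term m n → Set where
  comm : ∀ (p : Pat) {i j} (S : SCtx m n i j) {t r} →
         elim p (renˢ (uvs p ↑ʳ_) (lvs p ↑ʳ_) S
                  ⟪ ren (exch (uvs p) i) (exch (lvs p) j) t ⟫ₛ) r
           ≈ S ⟪ elim p t (wk i j r) ⟫ₛ
  unit : ∀ {t} → t [⋆≔ ⋆ ] ≈ t
  swap : ∀ {t s} → t [⋆≔ s ] ≈ s [⋆≔ t ]
  dual : ∀ {t t′ r} → t ⟪ zero ∖∖ ⋆ ⟫≔ t′ → t′ ♯ r ≈ t ⟪ zero ≔ r ⟫ₗ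

-- The requirement that both sides of an axiom be typed alike must be read
-- relative to the judgement in which the axiom is used: swap relates a[⋆:=b] to
-- b[⋆:=a] in the contexts a:𝟏, b:𝟏 but not in a:α, b:𝟏, where the latter is not
-- typable. So structural equivalence is a relation on terms in given contexts
-- and at a given type, and its contextual closure follows the typing rules.

infix 4 _⨾_⊢_∼_∶_ _⨾_⊢_≋_∶_ _⨾_⊢_⟶_∶_

data _⨾_⊢_∼_∶_ {X : Set} : ∀ {m n} → UCtx X m → LCtx X n →
                           Term m n → Term m n → Formula X → Set where
  ax    : ∀ {A t t′} {Δ : UCtx X m} {Γ : LCtx X n} →
          t ≈ t′ → Δ ⨾ Γ ⊢ t ∶ A → Δ ⨾ Γ ⊢ t′ ∶ A →
          Δ ⨾ Γ ⊢ t ∼ t′ ∶ A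
  pair₁ : ∀ {A B t t′ s} {Δ : UCtx X m} {Γ Γ′ Γ″ : LCtx X n} →
          Γ ⊎ Γ′ ≔ Γ″ →
          Δ ⨾ Γ ⊢ t ∼ t′ ∶ A → Δ ⨾ Γ′ ⊢ s ∶ B →
          Δ ⨾ Γ″ ⊢ ⟨ t , s ⟩ ∼ ⟨ t′ , s ⟩ ∶ A ⊗ B
  pair₂ : ∀ {A B t s s′} {Δ : UCtx X m} {Γ Γ′ Γ″ : LCtx X n} →
          Γ ⊎ Γ′ ≔ Γ″ →
          Δ ⨾ Γ ⊢ t ∶ A → Δ ⨾ Γ′ ⊢ s ∼ s′ ∶ B →
          Δ ⨾ Γ″ ⊢ ⟨ t , s ⟩ ∼ ⟨ t , s′ ⟩ ∶ A ⊗ B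
  let⊗₁ : ∀ {A B C t t′ s} {Δ : UCtx X m} {Γ Γ′ Γ″ : LCtx X n} →
          Γ ⊎ Γ′ ≔ Γ″ →
          Δ ⨾ Γ ⊢ s ∶ A ⊗ B → Δ ⨾ just A ∷ just B ∷ Γ′ ⊢ t ∼ t′ ∶ C →
          Δ ⨾ Γ″ ⊢ t [⟨⟩≔ s ] ∼ t′ [⟨⟩≔ s ] ∶ C
  let⊗₂ : ∀ {A B C t s s′} {Δ : UCtx X m} {Γ Γ′ Γ″ : LCtx X n} →
          Γ ⊎ Γ′ ≔ Γ″ →
          Δ ⨾ Γ ⊢ s ∼ s′ ∶ A ⊗ B → Δ ⨾ just A ∷ just B ∷ Γ′ ⊢ t ∶ C →
          Δ ⨾ Γ″ ⊢ t [⟨⟩≔ s ] ∼ t [⟨⟩≔ s′ ] ∶ C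
  par   : ∀ {A B t t′} {Δ : UCtx X m} {Γ : LCtx X n} →
          Δ ⨾ just A ∷ just B ∷ Γ ⊢ t ∼ t′ ∶ ⊥ →
          Δ ⨾ Γ ⊢ ⅋· t ∼ ⅋· t′ ∶ A ^⊥ ⅋ B ^⊥
  app•₁ : ∀ {A B t t′ s} {Δ : UCtx X m} {Γ Γ′ Γ″ : LCtx X n} →
          Γ ⊎ Γ′ ≔ Γ″ →
          Δ ⨾ Γ ⊢ t ∼ t′ ∶ A ⅋ B → Δ ⨾ Γ′ ⊢ s ∶ A ^⊥ →
          Δ ⨾ Γ″ ⊢ t • s ∼ t′ • s ∶ B
  app•₂ : ∀ {A B t s s′} {Δ : UCtx X m} {Γ Γ′ Γ″ : LCtx X n} →
          Γ ⊎ Γ′ ≔ Γ″ →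
          Δ ⨾ Γ ⊢ t ∶ A ⅋ B → Δ ⨾ Γ′ ⊢ s ∼ s′ ∶ A ^⊥ →
          Δ ⨾ Γ″ ⊢ t • s ∼ t • s′ ∶ B
  app▾₁ : ∀ {A B t t′ s} {Δ : UCtx X m} {Γ Γ′ Γ″ : LCtx X n} →
          Γ ⊎ Γ′ ≔ Γ″ →
          Δ ⨾ Γ ⊢ t ∼ t′ ∶ A ⅋ B → Δ ⨾ Γ′ ⊢ s ∶ B ^⊥ →
          Δ ⨾ Γ″ ⊢ t ▾ s ∼ t′ ▾ s ∶ A
  app▾₂ : ∀ {A B t s s′} {Δ : UCtx X m} {Γ Γ′ Γ″ : LCtx X n} →
          Γ ⊎ Γ′ ≔ Γ″ →
          Δ ⨾ Γ ⊢ t ∶ A ⅋ B → Δ ⨾ Γ′ ⊢ s ∼ s′ ∶ B ^⊥ →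
          Δ ⨾ Γ″ ⊢ t ▾ s ∼ t ▾ s′ ∶ A
  bang  : ∀ {A t t′} {Δ : UCtx X m} →
          Δ ⨾ just A ∷ ∅ {n = n} ⊢ t ∼ t′ ∶ ⊥ →
          Δ ⨾ ∅ {n = n} ⊢ !· t ∼ !· t′ ∶ ! (A ^⊥)
  let!₁ : ∀ {A B t t′ s} {Δ : UCtx X m} {Γ Γ′ Γ″ : LCtx X n} →
          Γ ⊎ Γ′ ≔ Γ″ →
          Δ ⨾ Γ ⊢ s ∶ ! A → A ∷ Δ ⨾ Γ′ ⊢ t ∼ t′ ∶ B →
          Δ ⨾ Γ″ ⊢ t [!≔ s ] ∼ t′ [!≔ s ] ∶ B
  let!₂ : ∀ {A B t s s′} {Δ : UCtx X m} {Γ Γ′ Γ″ : LCtx X n} →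
          Γ ⊎ Γ′ ≔ Γ″ →
          Δ ⨾ Γ ⊢ s ∼ s′ ∶ ! A → A ∷ Δ ⨾ Γ′ ⊢ t ∶ B →
          Δ ⨾ Γ″ ⊢ t [!≔ s ] ∼ t [!≔ s′ ] ∶ B
  whyn  : ∀ {A t t′} {Δ : UCtx X m} {Γ : LCtx X n} →
          A ^⊥ ∷ Δ ⨾ Γ ⊢ t ∼ t′ ∶ ⊥ →
          Δ ⨾ Γ ⊢ ?· t ∼ ?· t′ ∶ ¿ A
  ask₁  : ∀ {A t t′ s} {Δ : UCtx X m} {Γ : LCtx X n} →
          Δ ⨾ Γ ⊢ s ∶ ¿ A → Δ ⨾ just A ∷ ∅ ⊢ t ∼ t′ ∶ ⊥ →
          Δ ⨾ Γ ⊢ t ▸ s ∼ t′ ▸ s ∶ ⊥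
  ask₂  : ∀ {A t s s′} {Δ : UCtx X m} {Γ : LCtx X n} →
          Δ ⨾ Γ ⊢ s ∼ s′ ∶ ¿ A → Δ ⨾ just A ∷ ∅ ⊢ t ∶ ⊥ →
          Δ ⨾ Γ ⊢ t ▸ s ∼ t ▸ s′ ∶ ⊥
  cut₁  : ∀ {B t t′ s} {Δ : UCtx X m} {Γ Γ′ Γ″ : LCtx X n} →
          Γ ⊎ Γ′ ≔ Γ″ →
          Δ ⨾ Γ ⊢ t ∼ t′ ∶ B → Δ ⨾ Γ′ ⊢ s ∶ B ^⊥ →
          Δ ⨾ Γ″ ⊢ t ♯ s ∼ t′ ♯ s ∶ ⊥
  cut₂  : ∀ {B t s s′} {Δ : UCtx X m} {Γ Γ′ Γ″ : LCtx X n} →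
          Γ ⊎ Γ′ ≔ Γ″ →
          Δ ⨾ Γ ⊢ t ∶ B → Δ ⨾ Γ′ ⊢ s ∼ s′ ∶ B ^⊥ →
          Δ ⨾ Γ″ ⊢ t ♯ s ∼ t ♯ s′ ∶ ⊥
  let⋆₁ : ∀ {A t t′ s} {Δ : UCtx X m} {Γ Γ′ Γ″ : LCtx X n} →
          Γ ⊎ Γ′ ≔ Γ″ →
          Δ ⨾ Γ ⊢ s ∶ 𝟏 → Δ ⨾ Γ′ ⊢ t ∼ t′ ∶ A →
          Δ ⨾ Γ″ ⊢ t [⋆≔ s ] ∼ t′ [⋆≔ s ] ∶ A
  let⋆₂ : ∀ {A t s s′} {Δ : UCtx X m} {Γ Γ′ Γ″ : LCtx X n} →
          Γ ⊎ Γ′ ≔ Γ″ →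
          Δ ⨾ Γ ⊢ s ∼ s′ ∶ 𝟏 → Δ ⨾ Γ′ ⊢ t ∶ A →
          Δ ⨾ Γ″ ⊢ t [⋆≔ s ] ∼ t [⋆≔ s′ ] ∶ A

_⨾_⊢_≋_∶_ : ∀ {X m n} → UCtx X m → LCtx X n → Term m n → Term m n → Formula X → Set
Δ ⨾ Γ ⊢ t ≋ s ∶ A = EqClosure (λ t s → Δ ⨾ Γ ⊢ t ∼ s ∶ A) t s

_⨾_⊢_⟶_∶_ : ∀ {X m n} → UCtx X m → LCtx X n → Term m n → Term m n → Formula X → Set
Δ ⨾ Γ ⊢ t ⟶ s ∶ A = ∃₂ λ t′ s′ → Δ ⨾ Γ ⊢ t ≋ t′ ∶ A × t′ ⟶⁻ s′ × Δ ⨾ Γ ⊢ s′ ≋ s ∶ A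

{-# OPTIONS --safe #-}

-- Structural equivalence is typed by construction, so all the work is subject
-- reduction for ↦. Typing a redex around L splits into a typing of L and one of
-- the term in its hole. The resources of the other subterm of the redex are then
-- added to the contexts of L, outside and at the hole, and the contractum is
-- typed in the hole by three substitution lemmas: linear, unrestricted, and
-- contra-substitution, which from a : A ⊢ t : B and s : B^⊥ gives
-- t{a\\s} : A^⊥.
module Submission where

open import Defs
open import Data.Fin.Base using (Fin; zero; suc; lift; punchIn; _↑ʳ_)
open import Data.Maybe.Base using (Maybe; just; nothing)
open import Data.Nat.Base using (ℕ; suc; _+_)
open import Data.Product.Base using (∃; ∃₂; _×_; _,_; proj₁; proj₂)
open import Data.Sum.Base using (_⊎_; inj₁; inj₂)
open import Data.Vec.Base using (Vec; []; _∷_; lookup; _[_]≔_)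
open import Data.Vec.Functional using (insertAt)
open import Data.Vec.Functional.Properties using (insertAt-lookup; insertAt-punchIn)
open import Data.Vec.Properties using (∷-injectiveˡ; ∷-injectiveʳ)
open import Function.Base using (id; _∘_)
open import Relation.Binary.Construct.Closure.ReflexiveTransitive using (ε; _◅_)
open import Relation.Binary.Construct.Closure.Symmetric using (fwd; bwd)
open import Relation.Binary.PropositionalEquality using (_≡_; refl; sym; cong; cong₂; subst)

private variable
  X       : Set
  m n m′ n′ i j k l : ℕ
  A B C   : Formula X
  Δ Δ′ Δ₁ Δ₂ : UCtx X m
  Γ Γ′ Γ₁ Γ₂ Γ₃ Γ₁₂ Γ₂₃ Γ₃₄ Γ₄ : LCtx X n
  t t′ s r : Term m n
  ρ       : Fin m → Fin m′
  τ τ′    : Fin n → Fin n′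

-- Linear negation

^⊥-involutive : (A : Formula X) → A ^⊥ ^⊥ ≡ A
^⊥-involutive (atom _)  = refl
^⊥-involutive (atom⁻ _) = refl
^⊥-involutive (A ⊗ B)   = cong₂ _⊗_ (^⊥-involutive A) (^⊥-involutive B)
^⊥-involutive (A ⅋ B)   = cong₂ _⅋_ (^⊥-involutive A) (^⊥-involutive B)
^⊥-involutive 𝟏         = refl
^⊥-involutive ⊥         = refl
^⊥-involutive (! A)     = cong !_ (^⊥-involutive A)
^⊥-involutive (¿ A)     = cong ¿_ (^⊥-involutive A)

-- Negation is computed by recursion, so for a variable `A` the involution law is only
-- propositional, and derivations must be transported wherever a rule negates twice.
double-dual : Δ ⨾ Γ ⊢ t ∶ A → Δ ⨾ Γ ⊢ t ∶ A ^⊥ ^⊥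
double-dual {A = A} = subst (_ ⨾ _ ⊢ _ ∶_) (sym (^⊥-involutive A))

double-dual⁻¹ : Δ ⨾ Γ ⊢ t ∶ A ^⊥ ^⊥ → Δ ⨾ Γ ⊢ t ∶ A
double-dual⁻¹ {A = A} = subst (_ ⨾ _ ⊢ _ ∶_) (^⊥-involutive A)

cast-context : Γ ≡ Γ′ → Δ ⨾ Γ ⊢ t ∶ A → Δ ⨾ Γ′ ⊢ t ∶ A
cast-context refl d = d

-- Linear contexts

⊎-comm : Γ₁ ⊎ Γ₂ ≔ Γ → Γ₂ ⊎ Γ₁ ≔ Γ
⊎-comm []        = []
⊎-comm (none p)  = none (⊎-comm p)
⊎-comm (left p)  = right (⊎-comm p)
⊎-comm (right p) = left (⊎-comm p)

⊎-assoc : Γ₁ ⊎ Γ₂ ≔ Γ₁₂ → Γ₁₂ ⊎ Γ₃ ≔ Γ →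
          ∃ λ Γ₂₃ → (Γ₂ ⊎ Γ₃ ≔ Γ₂₃) × (Γ₁ ⊎ Γ₂₃ ≔ Γ)
⊎-assoc []        []        = _ , [] , []
⊎-assoc (none p)  (none q)  = let _ , p′ , q′ = ⊎-assoc p q in _ , none p′ , none q′
⊎-assoc (left p)  (left q)  = let _ , p′ , q′ = ⊎-assoc p q in _ , none p′ , left q′
⊎-assoc (right p) (left q)  = let _ , p′ , q′ = ⊎-assoc p q in _ , left p′ , right q′
⊎-assoc (none p)  (right q) = let _ , p′ , q′ = ⊎-assoc p q in _ , right p′ , right q′

⊎-assoc⁻¹ : Γ₂ ⊎ Γ₃ ≔ Γ₂₃ → Γ₁ ⊎ Γ₂₃ ≔ Γ →
            ∃ λ Γ₁₂ → (Γ₁ ⊎ Γ₂ ≔ Γ₁₂) × (Γ₁₂ ⊎ Γ₃ ≔ Γ)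
⊎-assoc⁻¹ p q = let _ , p′ , q′ = ⊎-assoc (⊎-comm p) (⊎-comm q) in _ , ⊎-comm p′ , ⊎-comm q′

⊎-interchange : Γ₁ ⊎ Γ₂ ≔ Γ₁₂ → Γ₃ ⊎ Γ₄ ≔ Γ₃₄ → Γ₁₂ ⊎ Γ₃₄ ≔ Γ →
                ∃₂ λ Γ₁₃ Γ₂₄ → (Γ₁ ⊎ Γ₃ ≔ Γ₁₃) × (Γ₂ ⊎ Γ₄ ≔ Γ₂₄) × (Γ₁₃ ⊎ Γ₂₄ ≔ Γ)
⊎-interchange p q r =
  let _ , a , b = ⊎-assoc p r
      _ , c , d = ⊎-assoc⁻¹ q a
      _ , e , f = ⊎-assoc (⊎-comm c) d
      _ , g , h = ⊎-assoc⁻¹ f b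
  in _ , _ , g , e , h

⊎-identityʳ : (Γ : LCtx X n) → Γ ⊎ ∅ ≔ Γ
⊎-identityʳ []            = []
⊎-identityʳ (nothing ∷ Γ) = none (⊎-identityʳ Γ)
⊎-identityʳ (just _ ∷ Γ)  = left (⊎-identityʳ Γ)

⊎-identityˡ : (Γ : LCtx X n) → ∅ ⊎ Γ ≔ Γ
⊎-identityˡ Γ = ⊎-comm (⊎-identityʳ Γ)

∅⊎-injective : ∅ ⊎ Γ₁ ≔ Γ → Γ₁ ≡ Γ
∅⊎-injective {Γ = []}    []        = refl
∅⊎-injective {Γ = _ ∷ _} (none p)  = cong (nothing ∷_) (∅⊎-injective p)
∅⊎-injective {Γ = _ ∷ _} (right p) = cong (just _ ∷_) (∅⊎-injective p)

-- Renaming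

-- The order-preserving embeddings among functions on indices. The function is
-- given only up to pointwise equality at keep, because lift 2 τ and
-- lift 1 (lift 1 τ) are not definitionally equal.
data Embedding : ∀ {n n′} → (Fin n → Fin n′) → Set where
  idᵉ  : Embedding (id {A = Fin n})
  skip : Embedding τ → Embedding (λ a → suc (τ a))
  keep : Embedding τ → τ′ zero ≡ zero → (∀ a → τ′ (suc a) ≡ suc (τ a)) → Embedding τ′

liftᵉ : ∀ k → Embedding τ → Embedding (lift k τ)
liftᵉ 0       E = E
liftᵉ (suc k) E = keep (liftᵉ k E) refl (λ _ → refl)

shiftᵉ : ∀ k {n} → Embedding {n} (k ↑ʳ_)
shiftᵉ 0       = idᵉ
shiftᵉ (suc k) = skip (shiftᵉ k)

thinᵉ : (a : Fin (suc n)) → Embedding (punchIn a)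
thinᵉ zero            = skip idᵉ
thinᵉ {suc n} (suc a) = keep (thinᵉ a) refl (λ _ → refl)

-- Recursion is on the embedding proof, so that pushing under binders with `liftᵉ 2 E` computes on
-- the entries of the bound variables. Positions outside the range of `τ` become `nothing`.
push : {τ : Fin n → Fin n′} → Embedding τ → LCtx X n → LCtx X n′
push idᵉ          Γ       = Γ
push (skip E)     Γ       = nothing ∷ push E Γ
push (keep E _ _) (x ∷ Γ) = x ∷ push E Γ

push-∅ : (E : Embedding τ) → push {X = X} E ∅ ≡ ∅
push-∅ idᵉ          = refl
push-∅ (skip E)     = cong (nothing ∷_) (push-∅ E)
push-∅ (keep E _ _) = cong (nothing ∷_) (push-∅ E)

push-∅⁻¹ : (E : Embedding τ) → push E Γ ≡ ∅ → Γ ≡ ∅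
push-∅⁻¹ idᵉ      eq = eq
push-∅⁻¹ (skip E) eq = push-∅⁻¹ E (∷-injectiveʳ eq)
push-∅⁻¹ {Γ = nothing ∷ _} (keep E _ _) eq = cong (nothing ∷_) (push-∅⁻¹ E (∷-injectiveʳ eq))

push-∷∅⁻¹ : ∀ {x} (E : Embedding τ) (p : τ′ zero ≡ zero) (q : ∀ a → τ′ (suc a) ≡ suc (τ a)) →
            x ∷ ∅ ≡ push (keep {τ′ = τ′} E p q) Γ → Γ ≡ x ∷ ∅
push-∷∅⁻¹ {Γ = _ ∷ _} E _ _ eq =
  cong₂ _∷_ (sym (∷-injectiveˡ eq)) (push-∅⁻¹ E (sym (∷-injectiveʳ eq)))

push-singleton : (E : Embedding τ) (a : Fin n) {A : Formula X} →
                 push E (∅ [ a ]≔ just A) ≡ ∅ [ τ a ]≔ just A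
push-singleton idᵉ          a                 = refl
push-singleton (skip E)     a                 = cong (nothing ∷_) (push-singleton E a)
push-singleton (keep E p q) zero    rewrite p   = cong (just _ ∷_) (push-∅ E)
push-singleton (keep E p q) (suc a) rewrite q a = cong (nothing ∷_) (push-singleton E a)

push-⊎ : (E : Embedding τ) → Γ₁ ⊎ Γ₂ ≔ Γ → push E Γ₁ ⊎ push E Γ₂ ≔ push E Γ
push-⊎ idᵉ          p         = p
push-⊎ (skip E)     p         = none (push-⊎ E p)
push-⊎ (keep E _ _) (none p)  = none (push-⊎ E p)
push-⊎ (keep E _ _) (left p)  = left (push-⊎ E p)
push-⊎ (keep E _ _) (right p) = right (push-⊎ E p)

push-∅⊎-injective : (E : Embedding τ) → push E ∅ ⊎ Γ₁ ≔ Γ → Γ₁ ≡ Γ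
push-∅⊎-injective E p = ∅⊎-injective (subst (_⊎ _ ≔ _) (push-∅ E) p)

-- At a position outside the range of `τ` both parts are `nothing`, hence so is their union.
push-⊎⁻¹ : (E : Embedding τ) {Γ₁ Γ₂ : LCtx X n} → push E Γ₁ ⊎ push E Γ₂ ≔ Γ′ →
           ∃ λ Γ → Γ′ ≡ push E Γ × (Γ₁ ⊎ Γ₂ ≔ Γ)
push-⊎⁻¹ idᵉ      p        = _ , refl , p
push-⊎⁻¹ (skip E) (none p) =
  let _ , eq , q = push-⊎⁻¹ E p in _ , cong (nothing ∷_) eq , q
push-⊎⁻¹ (keep E _ _) {nothing ∷ _} {nothing ∷ _} (none p)  =
  let _ , eq , q = push-⊎⁻¹ E p in _ , cong (nothing ∷_) eq , none q
push-⊎⁻¹ (keep E _ _) {just _ ∷ _} {nothing ∷ _} (left p)  =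
  let _ , eq , q = push-⊎⁻¹ E p in _ , cong (just _ ∷_) eq , left q
push-⊎⁻¹ (keep E _ _) {nothing ∷ _} {just _ ∷ _} (right p) =
  let _ , eq , q = push-⊎⁻¹ E p in _ , cong (just _ ∷_) eq , right q

-- Unrestricted variables may be dropped or duplicated, so preservation of types is the whole
-- condition on `ρ`; linear renamings go through `Embedding` instead.
Renames : (Fin m → Fin m′) → UCtx X m → UCtx X m′ → Set
Renames ρ Δ Δ′ = ∀ u → lookup Δ′ (ρ u) ≡ lookup Δ u

renames-lift : Renames ρ Δ Δ′ → Renames (lift 1 ρ) (A ∷ Δ) (A ∷ Δ′)
renames-lift R zero    = refl
renames-lift R (suc u) = R u

push-∅-⊢ : {τ : Fin n → Fin n′} (E : Embedding τ) → Δ ⨾ ∅ ⊢ t ∶ A → Δ ⨾ push E ∅ ⊢ t ∶ A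
push-∅-⊢ E = cast-context (sym (push-∅ E))

push-∅-⊢⁻¹ : {τ : Fin n → Fin n′} (E : Embedding τ) → Δ ⨾ push E ∅ ⊢ t ∶ A → Δ ⨾ ∅ ⊢ t ∶ A
push-∅-⊢⁻¹ E = cast-context (push-∅ E)

ren-⊢ : (E : Embedding τ) → Renames ρ Δ Δ′ →
        Δ ⨾ Γ ⊢ t ∶ A → Δ′ ⨾ push E Γ ⊢ ren ρ τ t ∶ A
ren-⊢ E R (ax a) = cast-context (sym (push-singleton E a)) (ax _)
ren-⊢ {ρ = ρ} E R (uax u) = push-∅-⊢ E (subst (_ ⨾ ∅ ⊢ _ ∶_) (R u) (uax (ρ u)))
ren-⊢ E R (⊗I p d e)  = ⊗I (push-⊎ E p) (ren-⊢ E R d) (ren-⊢ E R e)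
ren-⊢ E R (⊗E p d e)  = ⊗E (push-⊎ E p) (ren-⊢ E R d) (ren-⊢ (liftᵉ 2 E) R e)
ren-⊢ E R (⅋I d)      = ⅋I (ren-⊢ (liftᵉ 2 E) R d)
ren-⊢ E R (⅋E• p d e) = ⅋E• (push-⊎ E p) (ren-⊢ E R d) (ren-⊢ E R e)
ren-⊢ E R (⅋E▾ p d e) = ⅋E▾ (push-⊎ E p) (ren-⊢ E R d) (ren-⊢ E R e)
-- `!I` asks for a literal `∅`, while `push E ∅` equals it only propositionally, so both premise and
-- conclusion are cast.
ren-⊢ E R (!I d) =
  push-∅-⊢ E (!I (cast-context (cong (just _ ∷_) (push-∅ E)) (ren-⊢ (liftᵉ 1 E) R d)))
ren-⊢ E R (!E p d e)  = !E (push-⊎ E p) (ren-⊢ E R d) (ren-⊢ E (renames-lift R) e)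
ren-⊢ E R (?I d)      = ?I (ren-⊢ E (renames-lift R) d)
ren-⊢ E R (?E d e)    =
  ?E (ren-⊢ E R d)
     (cast-context (cong (just _ ∷_) (push-∅ E)) (ren-⊢ (liftᵉ 1 E) R e))
ren-⊢ E R (cut p d e) = cut (push-⊎ E p) (ren-⊢ E R d) (ren-⊢ E R e)
ren-⊢ E R 𝟏I          = push-∅-⊢ E 𝟏I
ren-⊢ E R (𝟏E p d e)  = 𝟏E (push-⊎ E p) (ren-⊢ E R d) (ren-⊢ E R e)

wk-linear-⊢ : ∀ j → Δ ⨾ Γ ⊢ t ∶ A → Δ ⨾ push (shiftᵉ j) Γ ⊢ wk 0 j t ∶ A
wk-linear-⊢ j = ren-⊢ (shiftᵉ j) (λ _ → refl)

wk-unrestricted-⊢ : Δ ⨾ Γ ⊢ t ∶ A → B ∷ Δ ⨾ Γ ⊢ wk 1 0 t ∶ A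
wk-unrestricted-⊢ = ren-⊢ idᵉ (λ _ → refl)

-- The leaves of a derivation have exactly the linear variables they use in context, so a variable
-- outside the range of `τ` cannot enter the context of a renamed term. For `thin a t` this says
-- that `t` takes no share of `a`.
strengthen : (E : Embedding τ) → Renames ρ Δ Δ′ → ∀ t →
             Δ′ ⨾ Γ′ ⊢ ren ρ τ t ∶ A → ∃ λ Γ → Γ′ ≡ push E Γ × (Δ ⨾ Γ ⊢ t ∶ A)

-- For the bodies of `!·_` and `_▸_`. Leaving `τ′` abstract covers both `lift 1 τ` and
-- `punchIn (suc a)`.
strengthen-singleton : (E : Embedding τ) (p : τ′ zero ≡ zero) (q : ∀ a → τ′ (suc a) ≡ suc (τ a)) →
                       Renames ρ Δ Δ′ → ∀ t →
                       Δ′ ⨾ just B ∷ ∅ ⊢ ren ρ τ′ t ∶ A → Δ ⨾ just B ∷ ∅ ⊢ t ∶ A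
strengthen-singleton {τ′ = τ′} E p q R t d with strengthen (keep {τ′ = τ′} E p q) R t d
... | _ , eq , d′ = cast-context (push-∷∅⁻¹ {τ′ = τ′} E p q eq) d′

strengthen E R (lvar a) (ax _) = _ , sym (push-singleton E a) , ax a
strengthen E R (uvar u) (uax _) rewrite R u = ∅ , sym (push-∅ E) , uax u
strengthen E R ⟨ t , s ⟩ (⊗I p d e)
  with strengthen E R t d | strengthen E R s e
... | _ , refl , d′ | _ , refl , e′ with push-⊎⁻¹ E p
... | _ , refl , q = _ , refl , ⊗I q d′ e′
strengthen E R (t [⟨⟩≔ s ]) (⊗E p d e)
  with strengthen E R s d | strengthen (liftᵉ 2 E) R t e
... | _ , refl , d′ | _ ∷ _ ∷ _ , refl , e′ with push-⊎⁻¹ E p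
... | _ , refl , q = _ , refl , ⊗E q d′ e′
strengthen E R (⅋· t) (⅋I d) with strengthen (liftᵉ 2 E) R t d
... | _ ∷ _ ∷ _ , refl , d′ = _ , refl , ⅋I d′
strengthen E R (t • s) (⅋E• p d e)
  with strengthen E R t d | strengthen E R s e
... | _ , refl , d′ | _ , refl , e′ with push-⊎⁻¹ E p
... | _ , refl , q = _ , refl , ⅋E• q d′ e′
strengthen E R (t ▾ s) (⅋E▾ p d e)
  with strengthen E R t d | strengthen E R s e
... | _ , refl , d′ | _ , refl , e′ with push-⊎⁻¹ E p
... | _ , refl , q = _ , refl , ⅋E▾ q d′ e′
strengthen E R (!· t) (!I d) = _ , sym (push-∅ E) , !I (strengthen-singleton E refl (λ _ → refl) R t d)
strengthen E R (t [!≔ s ]) (!E p d e)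
  with strengthen E R s d | strengthen E (renames-lift R) t e
... | _ , refl , d′ | _ , refl , e′ with push-⊎⁻¹ E p
... | _ , refl , q = _ , refl , !E q d′ e′
strengthen E R (?· t) (?I d) with strengthen E (renames-lift R) t d
... | _ , refl , d′ = _ , refl , ?I d′
strengthen E R (t ▸ s) (?E d e) with strengthen E R s d
... | _ , refl , d′ = _ , refl , ?E d′ (strengthen-singleton E refl (λ _ → refl) R t e)
strengthen E R (t ♯ s) (cut p d e)
  with strengthen E R t d | strengthen E R s e
... | _ , refl , d′ | _ , refl , e′ with push-⊎⁻¹ E p
... | _ , refl , q = _ , refl , cut q d′ e′
strengthen E R ⋆ 𝟏I = _ , sym (push-∅ E) , 𝟏I
strengthen E R (t [⋆≔ s ]) (𝟏E p d e)
  with strengthen E R s d | strengthen E R t e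
... | _ , refl , d′ | _ , refl , e′ with push-⊎⁻¹ E p
... | _ , refl , q = _ , refl , 𝟏E q d′ e′

-- Substitution

-- A relation, so that it can be matched alongside a splitting. It serves linear contexts, where the
-- entry may be `nothing`, and unrestricted ones.
data Insert {Y : Set} : ∀ {n} → Fin (suc n) → Y → Vec Y n → Vec Y (suc n) → Set where
  here  : ∀ {x} {xs : Vec Y n} → Insert zero x xs (x ∷ xs)
  there : ∀ {a x y} {xs : Vec Y n} {ys} → Insert a x xs ys → Insert (suc a) x (y ∷ xs) (y ∷ ys)

insert-∅ : ∀ {a : Fin (suc n)} {x} → Insert a x Γ ∅ → x ≡ nothing × Γ ≡ ∅
insert-∅ here = refl , refl
insert-∅ {n = suc _} (there i) with refl , refl ← insert-∅ i = refl , refl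

insert-thin : ∀ (a : Fin (suc n)) {x} {Γ Γ′ : LCtx X n} →
              Insert a x Γ (push (thinᵉ a) Γ′) → x ≡ nothing × Γ ≡ Γ′
insert-thin zero here = refl , refl
insert-thin {n = suc _} (suc a) {Γ′ = _ ∷ _} (there i) with refl , refl ← insert-thin a i = refl , refl

insert-singleton : ∀ {a : Fin (suc n)} {x} (b : Fin (suc n)) → Insert a x Γ (∅ [ b ]≔ just A) →
                   (b ≡ a × x ≡ just A × Γ ≡ ∅) ⊎
                   (∃ λ c → b ≡ punchIn a c × x ≡ nothing × Γ ≡ ∅ [ c ]≔ just A)
insert-singleton zero    here      = inj₁ (refl , refl , refl)
insert-singleton (suc b) here      = inj₂ (b , refl , refl , refl)
insert-singleton {n = suc _} zero (there i) with refl , refl ← insert-∅ i =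
  inj₂ (zero , refl , refl , refl)
insert-singleton {n = suc _} (suc b) (there i) with insert-singleton b i
... | inj₁ (refl , refl , refl)     = inj₁ (refl , refl , refl)
... | inj₂ (c , refl , refl , refl) = inj₂ (suc c , refl , refl , refl)

-- The fate of the entry at `a` is recorded as a splitting of one-element contexts; matching on it
-- tells which side owns `a`.
insert-⊎ : ∀ {a : Fin (suc n)} {x} → Γ₁ ⊎ Γ₂ ≔ Γ → Insert a x Γ′ Γ →
           ∃₂ λ x₁ x₂ → ∃₂ λ Γ₁′ Γ₂′ →
             (x₁ ∷ [] ⊎ x₂ ∷ [] ≔ x ∷ []) × Insert a x₁ Γ₁′ Γ₁ × Insert a x₂ Γ₂′ Γ₂ × (Γ₁′ ⊎ Γ₂′ ≔ Γ′)
insert-⊎ (none p)  here = _ , _ , _ , _ , none [] , here , here , p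
insert-⊎ (left p)  here = _ , _ , _ , _ , left [] , here , here , p
insert-⊎ (right p) here = _ , _ , _ , _ , right [] , here , here , p
insert-⊎ (none p) (there i) =
  let _ , _ , _ , _ , x , i₁ , i₂ , q = insert-⊎ p i in _ , _ , _ , _ , x , there i₁ , there i₂ , none q
insert-⊎ (left p) (there i) =
  let _ , _ , _ , _ , x , i₁ , i₂ , q = insert-⊎ p i in _ , _ , _ , _ , x , there i₁ , there i₂ , left q
insert-⊎ (right p) (there i) =
  let _ , _ , _ , _ , x , i₁ , i₂ , q = insert-⊎ p i in _ , _ , _ , _ , x , there i₁ , there i₂ , right q

-- The resources that t ⟪ a ≔ r ⟫ₗ consumes at a: those of r if a is in the
-- context of t, and none otherwise, even though r is then still well-scoped.
data Argument (Δ : UCtx X m) (r : Term m n) : Maybe (Formula X) → LCtx X n → Set where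
  unused : Argument Δ r nothing ∅
  used   : Δ ⨾ Γ ⊢ r ∶ A → Argument Δ r (just A) Γ

-- The induction hypothesis of linear substitution. Admitting an absent `a` lets the induction enter
-- both subterms of a binary constructor, though at most one of them owns `a`.
data Fill (Δ : UCtx X m) (a : Fin (suc n)) (r : Term m n) (Γ′ : LCtx X (suc n)) (Γ : LCtx X n) : Set where
  fill : ∀ {x} → Insert a x Γ₁ Γ′ → Argument Δ r x Γ₂ → Γ₁ ⊎ Γ₂ ≔ Γ → Fill Δ a r Γ′ Γ

fill-⊎ : ∀ {a} → Γ₁ ⊎ Γ₂ ≔ Γ′ → Fill Δ a r Γ′ Γ →
         ∃₂ λ Γ₁′ Γ₂′ → Fill Δ a r Γ₁ Γ₁′ × Fill Δ a r Γ₂ Γ₂′ × (Γ₁′ ⊎ Γ₂′ ≔ Γ)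
fill-⊎ p (fill i arg q) with insert-⊎ p i
fill-⊎ p (fill i unused q) | _ , _ , _ , _ , none [] , i₁ , i₂ , p′ =
  let _ , _ , q₁ , q₂ , q′ = ⊎-interchange p′ (⊎-identityʳ ∅) q
  in _ , _ , fill i₁ unused q₁ , fill i₂ unused q₂ , q′
fill-⊎ p (fill i (used d) q) | _ , _ , _ , _ , left [] , i₁ , i₂ , p′ =
  let _ , _ , q₁ , q₂ , q′ = ⊎-interchange p′ (⊎-identityʳ _) q
  in _ , _ , fill i₁ (used d) q₁ , fill i₂ unused q₂ , q′
fill-⊎ p (fill i (used d) q) | _ , _ , _ , _ , right [] , i₁ , i₂ , p′ =
  let _ , _ , q₁ , q₂ , q′ = ⊎-interchange p′ (⊎-identityˡ _) q
  in _ , _ , fill i₁ unused q₁ , fill i₂ (used d) q₂ , q′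

fill-∅ : ∀ {a : Fin (suc n)} → Fill Δ a r ∅ Γ → Γ ≡ ∅
fill-∅ (fill i arg q) with insert-∅ i
fill-∅ (fill i unused q) | refl , refl = sym (∅⊎-injective q)

∅-insert : (a : Fin (suc n)) → Insert {Maybe (Formula X)} a nothing ∅ ∅
∅-insert zero            = here
∅-insert {suc _} (suc a) = there (∅-insert a)

∅-fill : (a : Fin (suc n)) → Fill Δ a r ∅ ∅
∅-fill a = fill (∅-insert a) unused (⊎-identityʳ ∅)

⊎-cons : ∀ x → Γ₁ ⊎ Γ₂ ≔ Γ → x ∷ Γ₁ ⊎ nothing ∷ Γ₂ ≔ x ∷ Γ
⊎-cons nothing  = none
⊎-cons (just _) = left

fill-linear : ∀ {a : Fin (suc n)} {x} → Fill Δ a r Γ′ Γ → Fill Δ (suc a) (wk 0 1 r) (x ∷ Γ′) (x ∷ Γ)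
fill-linear (fill i unused q)   = fill (there i) unused (⊎-cons _ q)
fill-linear (fill i (used d) q) =
  fill (there i) (used (wk-linear-⊢ 1 d)) (⊎-cons _ q)

fill-linear₂ : ∀ {a : Fin (suc n)} {x y} →
               Fill Δ a r Γ′ Γ → Fill Δ (suc (suc a)) (wk 0 2 r) (x ∷ y ∷ Γ′) (x ∷ y ∷ Γ)
fill-linear₂ (fill i unused q)   = fill (there (there i)) unused (⊎-cons _ (⊎-cons _ q))
fill-linear₂ (fill i (used d) q) =
  fill (there (there i)) (used (wk-linear-⊢ 2 d)) (⊎-cons _ (⊎-cons _ q))

fill-unrestricted : ∀ {a : Fin (suc n)} → Fill Δ a r Γ′ Γ → Fill (A ∷ Δ) a (wk 1 0 r) Γ′ Γ
fill-unrestricted (fill i unused q)   = fill i unused q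
fill-unrestricted (fill i (used d) q) = fill i (used (wk-unrestricted-⊢ d)) q

fill-var : ∀ {a} (b : Fin (suc n)) → Fill Δ a r (∅ [ b ]≔ just A) Γ → Δ ⨾ Γ ⊢ insertAt lvar a r b ∶ A
fill-var b (fill i arg q) with insert-singleton b i
fill-var {r = r} {a = a} .a (fill i (used d) q) | inj₁ (refl , refl , refl)
  rewrite insertAt-lookup lvar a r | ∅⊎-injective q = d
fill-var {r = r} {a = a} b (fill i unused q) | inj₂ (c , refl , refl , refl)
  rewrite insertAt-punchIn lvar a r c | sym (∅⊎-injective (⊎-comm q)) = ax c

subₗ-⊢ : ∀ {a} → Δ ⨾ Γ′ ⊢ t ∶ A → Fill Δ a r Γ′ Γ → Δ ⨾ Γ ⊢ t ⟪ a ≔ r ⟫ₗ ∶ A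
subₗ-⊢ (ax b) f = fill-var b f
subₗ-⊢ (uax u) f with refl ← fill-∅ f = uax u
subₗ-⊢ (⊗I p d e) f =
  let _ , _ , f₁ , f₂ , q = fill-⊎ p f in ⊗I q (subₗ-⊢ d f₁) (subₗ-⊢ e f₂)
subₗ-⊢ (⊗E p d e) f =
  let _ , _ , f₁ , f₂ , q = fill-⊎ p f in ⊗E q (subₗ-⊢ d f₁) (subₗ-⊢ e (fill-linear₂ f₂))
subₗ-⊢ (⅋I d) f = ⅋I (subₗ-⊢ d (fill-linear₂ f))
subₗ-⊢ (⅋E• p d e) f =
  let _ , _ , f₁ , f₂ , q = fill-⊎ p f in ⅋E• q (subₗ-⊢ d f₁) (subₗ-⊢ e f₂)
subₗ-⊢ (⅋E▾ p d e) f =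
  let _ , _ , f₁ , f₂ , q = fill-⊎ p f in ⅋E▾ q (subₗ-⊢ d f₁) (subₗ-⊢ e f₂)
subₗ-⊢ (!I d) f with refl ← fill-∅ f = !I (subₗ-⊢ d (fill-linear f))
subₗ-⊢ (!E p d e) f =
  let _ , _ , f₁ , f₂ , q = fill-⊎ p f in !E q (subₗ-⊢ d f₁) (subₗ-⊢ e (fill-unrestricted f₂))
subₗ-⊢ (?I d) f = ?I (subₗ-⊢ d (fill-unrestricted f))
-- The body's context holds only its bound variable, so `a` is absent there and `r` is consumed by
-- the scrutinee alone.
subₗ-⊢ (?E d e) f = ?E (subₗ-⊢ d f) (subₗ-⊢ e (fill-linear (∅-fill _)))
subₗ-⊢ (cut p d e) f =
  let _ , _ , f₁ , f₂ , q = fill-⊎ p f in cut q (subₗ-⊢ d f₁) (subₗ-⊢ e f₂)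
subₗ-⊢ 𝟏I f with refl ← fill-∅ f = 𝟏I
subₗ-⊢ (𝟏E p d e) f =
  let _ , _ , f₁ , f₂ , q = fill-⊎ p f in 𝟏E q (subₗ-⊢ d f₁) (subₗ-⊢ e f₂)

sub-pair-⊢ : Γ₂ ⊎ Γ₃ ≔ Γ₂₃ → Γ₁ ⊎ Γ₂₃ ≔ Γ →
             Δ ⨾ just A ∷ just B ∷ Γ₁ ⊢ t ∶ C → Δ ⨾ Γ₂ ⊢ s ∶ A → Δ ⨾ Γ₃ ⊢ r ∶ B →
             Δ ⨾ Γ ⊢ t ⟪ zero ≔ wk 0 1 s ⟫ₗ ⟪ zero ≔ r ⟫ₗ ∶ C
sub-pair-⊢ p q d e f =
  let _ , p′ , q′ = ⊎-assoc⁻¹ p q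
  in subₗ-⊢ (subₗ-⊢ d (fill here (used (wk-linear-⊢ 1 e)) (left p′)))
            (fill here (used f) q′)

-- Generalised from `uvar` to a family `f`, because the recursion passes to `f ∘ suc`.
insertAt-⊢ : ∀ {u} {f : Fin m → Term m′ n} → Insert u A Δ Δ′ → Δ₁ ⨾ ∅ ⊢ r ∶ A →
             (∀ v → Δ₁ ⨾ ∅ ⊢ f v ∶ lookup Δ v) → ∀ v → Δ₁ ⨾ ∅ ⊢ insertAt f u r v ∶ lookup Δ′ v
insertAt-⊢ here              d e zero    = d
insertAt-⊢ here              d e (suc v) = e v
insertAt-⊢ {m = suc _} (there i) d e zero    = e zero
insertAt-⊢ {m = suc _} (there i) d e (suc v) = insertAt-⊢ i d (e ∘ suc) v

wk-closed-⊢ : ∀ j → Δ ⨾ ∅ ⊢ r ∶ A → Δ ⨾ ∅ ⊢ wk 0 j r ∶ A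
wk-closed-⊢ j d =
  push-∅-⊢⁻¹ (shiftᵉ j) (wk-linear-⊢ j d)

-- Since `r` consumes no linear resources, copying or dropping it leaves every splitting intact.
subᵤ-⊢ : ∀ {u} → Δ′ ⨾ Γ ⊢ t ∶ A → Insert u B Δ Δ′ → Δ ⨾ ∅ ⊢ r ∶ B → Δ ⨾ Γ ⊢ t ⟪ u ≔ r ⟫ᵤ ∶ A
subᵤ-⊢ (ax a)       i f = ax a
subᵤ-⊢ (uax v)      i f = insertAt-⊢ i f uax v
subᵤ-⊢ (⊗I p d e)   i f = ⊗I p (subᵤ-⊢ d i f) (subᵤ-⊢ e i f)
subᵤ-⊢ (⊗E p d e)   i f = ⊗E p (subᵤ-⊢ d i f) (subᵤ-⊢ e i (wk-closed-⊢ 2 f))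
subᵤ-⊢ (⅋I d)       i f = ⅋I (subᵤ-⊢ d i (wk-closed-⊢ 2 f))
subᵤ-⊢ (⅋E• p d e)  i f = ⅋E• p (subᵤ-⊢ d i f) (subᵤ-⊢ e i f)
subᵤ-⊢ (⅋E▾ p d e)  i f = ⅋E▾ p (subᵤ-⊢ d i f) (subᵤ-⊢ e i f)
subᵤ-⊢ (!I d)       i f = !I (subᵤ-⊢ d i (wk-closed-⊢ 1 f))
subᵤ-⊢ (!E p d e)   i f = !E p (subᵤ-⊢ d i f) (subᵤ-⊢ e (there i) (wk-unrestricted-⊢ f))
subᵤ-⊢ (?I d)       i f = ?I (subᵤ-⊢ d (there i) (wk-unrestricted-⊢ f))
subᵤ-⊢ (?E d e)     i f = ?E (subᵤ-⊢ d i f) (subᵤ-⊢ e i (wk-closed-⊢ 1 f))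
subᵤ-⊢ (cut p d e)  i f = cut p (subᵤ-⊢ d i f) (subᵤ-⊢ e i f)
subᵤ-⊢ 𝟏I           i f = 𝟏I
subᵤ-⊢ (𝟏E p d e)   i f = 𝟏E p (subᵤ-⊢ d i f) (subᵤ-⊢ e i f)

-- Contra-substitution

-- Strengthening shows that the thinned subterm has no share of `a`, so the other side of the
-- splitting must own it.
thin-split : ∀ {a : Fin (suc n)} {t : Term m n} → Γ₁ ⊎ Γ₂ ≔ Γ′ → Insert a (just A) Γ Γ′ →
             Δ ⨾ Γ₂ ⊢ thin a t ∶ B →
             ∃₂ λ Γ₁′ Γ₂′ → Insert a (just A) Γ₁′ Γ₁ × (Δ ⨾ Γ₂′ ⊢ t ∶ B) × (Γ₁′ ⊎ Γ₂′ ≔ Γ)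
thin-split {a = a} {t = t} p i d
  with strengthen (thinᵉ a) (λ _ → refl) t d | insert-⊎ p i
... | Γ₂′ , refl , d′ | _ , _ , _ , _ , x , i₁ , i₂ , q with insert-thin a {Γ′ = Γ₂′} i₂
thin-split p i d | _ , refl , d′ | _ , _ , _ , _ , left [] , i₁ , i₂ , q | refl , refl =
  _ , _ , i₁ , d′ , q

-- The accumulator always has the dual of the type of the subterm being entered. Clauses that
-- combine the sibling with `s` move the sibling's resources along, by `⊎-assoc`; at the variable
-- the accumulator is itself the result.
contra-⊢ : ∀ {a : Fin (suc n)} → t ⟪ a ∖∖ s ⟫≔ r → Insert a (just A) Γ₁ Γ′ →
           Δ ⨾ Γ′ ⊢ t ∶ B → Δ ⨾ Γ₂ ⊢ s ∶ B ^⊥ → Γ₁ ⊎ Γ₂ ≔ Γ → Δ ⨾ Γ ⊢ r ∶ A ^⊥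
contra-⊢ var i (ax a) f q with insert-singleton a i
... | inj₁ (_ , refl , refl) with refl ← ∅⊎-injective q = f
contra-⊢ (pair₁ c) i (⊗I p d e) f q =
  let _ , _ , i′ , e′ , p′ = thin-split p i e
      _ , q₁ , q₂ = ⊎-assoc p′ q
  in contra-⊢ c i′ d (⅋E▾ (⊎-comm q₁) f (double-dual e′)) q₂
contra-⊢ (pair₂ c) i (⊗I p d e) f q =
  let _ , _ , i′ , d′ , p′ = thin-split (⊎-comm p) i d
      _ , q₁ , q₂ = ⊎-assoc p′ q
  in contra-⊢ c i′ e (⅋E• (⊎-comm q₁) f (double-dual d′)) q₂
contra-⊢ (app•₁ c) i (⅋E• p d e) f q =
  let _ , _ , i′ , e′ , p′ = thin-split p i e
      _ , q₁ , q₂ = ⊎-assoc p′ q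
  in contra-⊢ c i′ d (⊗I q₁ e′ f) q₂
contra-⊢ (app•₂ c) i (⅋E• p d e) f q =
  let _ , _ , i′ , d′ , p′ = thin-split (⊎-comm p) i d
      _ , q₁ , q₂ = ⊎-assoc p′ q
  in contra-⊢ c i′ e (double-dual (⅋E▾ q₁ d′ f)) q₂
contra-⊢ (app▾₁ c) i (⅋E▾ p d e) f q =
  let _ , _ , i′ , e′ , p′ = thin-split p i e
      _ , q₁ , q₂ = ⊎-assoc p′ q
  in contra-⊢ c i′ d (⊗I (⊎-comm q₁) f e′) q₂
contra-⊢ (app▾₂ c) i (⅋E▾ p d e) f q =
  let _ , _ , i′ , d′ , p′ = thin-split (⊎-comm p) i d
      _ , q₁ , q₂ = ⊎-assoc p′ q
  in contra-⊢ c i′ e (double-dual (⅋E• q₁ d′ f)) q₂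
contra-⊢ (let⊗₁ c) i (⊗E p d e) f q =
  let _ , _ , i′ , d′ , p′ = thin-split (⊎-comm p) i d
      _ , q₁ , q₂ = ⊎-assoc (⊎-comm p′) q
  in ⊗E q₂ d′ (contra-⊢ c (there (there i′)) e (wk-linear-⊢ 2 f) (left (left q₁)))
contra-⊢ (let⊗₂ c) i (⊗E p d e) f q
  -- The pattern variables belong to the body, so the splitting is first extended on its side.
  with thin-split (right (right p)) (there (there i)) e
... | _ , _ , there (there i′) , e′ , right (right p′) =
  let _ , q₁ , q₂ = ⊎-assoc p′ q
  in contra-⊢ c i′ d (⅋I (cut (left (left q₁)) e′ (wk-linear-⊢ 2 f))) q₂
contra-⊢ (par c) i (⅋I {A = A} {B = B} d) f q =
  -- The type of `s` computes to `(A ⊗ B) ^⊥ ^⊥`. The body has type `⊥`, so its accumulator `⋆` has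
  -- type `⊥ ^⊥`, that is `𝟏`.
  ⊗E (⊎-comm q) (double-dual⁻¹ {A = A ⊗ B} f)
     (contra-⊢ c (there (there i)) d 𝟏I (⊎-identityʳ _))
contra-⊢ (let!₁ c) i (!E p d e) f q =
  let _ , _ , i′ , d′ , p′ = thin-split (⊎-comm p) i d
      _ , q₁ , q₂ = ⊎-assoc (⊎-comm p′) q
  in !E q₂ d′ (contra-⊢ c i′ e (wk-unrestricted-⊢ f) q₁)
contra-⊢ (let!₂ c) i (!E {A = A} p d e) f q =
  let _ , _ , i′ , e′ , p′ = thin-split p i e
      Γ″ , q₁ , q₂ = ⊎-assoc p′ q
  in contra-⊢ c i′ d (?I
       -- To conclude `¿ (A ^⊥)`, `?I` must bind `u` at `A ^⊥ ^⊥`, whereas `!E` binds it at `A`.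
       (subst (λ C → C ∷ _ ⨾ Γ″ ⊢ _ ∶ _) (sym (^⊥-involutive A)) (cut q₁ e′ (wk-unrestricted-⊢ f)))) q₂
contra-⊢ (whyn c) i (?I d) f q = !E (⊎-comm q) f (contra-⊢ c i d 𝟏I (⊎-identityʳ _))
-- Here and in the two cuts the term has type `⊥`, so `s` has type `𝟏` and is consumed by `𝟏E`.
contra-⊢ {a = a} (ask₂ {t₁ = t₁} c) i (?E d e) f q =
  𝟏E (⊎-comm q) f (contra-⊢ c i d (!I e′) (⊎-identityʳ _))
  where e′ = strengthen-singleton (thinᵉ a) refl (λ _ → refl) (λ _ → refl) t₁ e
contra-⊢ (cut₁ c) i (cut p d e) f q =
  let _ , _ , i′ , e′ , p′ = thin-split p i e
  in 𝟏E (⊎-comm q) f (contra-⊢ c i′ d e′ p′)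
contra-⊢ (cut₂ c) i (cut p d e) f q =
  let _ , _ , i′ , d′ , p′ = thin-split (⊎-comm p) i d
  in 𝟏E (⊎-comm q) f (contra-⊢ c i′ e (double-dual d′) p′)
contra-⊢ (let⋆₁ c) i (𝟏E p d e) f q =
  let _ , _ , i′ , d′ , p′ = thin-split (⊎-comm p) i d
      _ , q₁ , q₂ = ⊎-assoc (⊎-comm p′) q
  in 𝟏E q₂ d′ (contra-⊢ c i′ e f q₁)
contra-⊢ (let⋆₂ c) i (𝟏E p d e) f q =
  let _ , _ , i′ , e′ , p′ = thin-split p i e
      _ , q₁ , q₂ = ⊎-assoc p′ q
  in contra-⊢ c i′ d (cut q₁ e′ f) q₂

-- Positive elimination contexts

infix 4 _⨾_⊢_⊣_⨾_

-- The contexts outside `L` are on the left, those at its hole on the right. No formula is recorded,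
-- since a positive elimination has the type of its body.
data _⨾_⊢_⊣_⨾_ {X : Set} {m n} (Δ : UCtx X m) (Γ : LCtx X n) :
               PCtx m n i j → UCtx X (i + m) → LCtx X (j + n) → Set where
  □     : Δ ⨾ Γ ⊢ □ ⊣ Δ ⨾ Γ
  let⊗  : ∀ {L : PCtx m n i j} {Δ′ Γ′ Γ₁ Γ₂ s A B} →
          Δ ⨾ Γ ⊢ L ⊣ Δ′ ⨾ Γ′ → Γ₁ ⊎ Γ₂ ≔ Γ′ → Δ′ ⨾ Γ₁ ⊢ s ∶ A ⊗ B →
          Δ ⨾ Γ ⊢ L ▹[⟨⟩≔ s ] ⊣ Δ′ ⨾ just A ∷ just B ∷ Γ₂
  let!  : ∀ {L : PCtx m n i j} {Δ′ Γ′ Γ₁ Γ₂ s A} →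
          Δ ⨾ Γ ⊢ L ⊣ Δ′ ⨾ Γ′ → Γ₁ ⊎ Γ₂ ≔ Γ′ → Δ′ ⨾ Γ₁ ⊢ s ∶ ! A →
          Δ ⨾ Γ ⊢ L ▹[!≔ s ] ⊣ A ∷ Δ′ ⨾ Γ₂
  let⋆  : ∀ {L : PCtx m n i j} {Δ′ Γ′ Γ₁ Γ₂ s} →
          Δ ⨾ Γ ⊢ L ⊣ Δ′ ⨾ Γ′ → Γ₁ ⊎ Γ₂ ≔ Γ′ → Δ′ ⨾ Γ₁ ⊢ s ∶ 𝟏 →
          Δ ⨾ Γ ⊢ L ▹[⋆≔ s ] ⊣ Δ′ ⨾ Γ₂

private variable
  L K : PCtx m n i j

decompose : (L : PCtx m n i j) → Δ ⨾ Γ ⊢ L ⟦ t ⟧ ∶ A →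
            ∃₂ λ Δ′ Γ′ → (Δ ⨾ Γ ⊢ L ⊣ Δ′ ⨾ Γ′) × (Δ′ ⨾ Γ′ ⊢ t ∶ A)
decompose □ d = _ , _ , □ , d
decompose (L ▹[⟨⟩≔ _ ]) d with decompose L d
... | _ , _ , c , ⊗E p e f = _ , _ , let⊗ c p e , f
decompose (L ▹[!≔ _ ]) d with decompose L d
... | _ , _ , c , !E p e f = _ , _ , let! c p e , f
decompose (L ▹[⋆≔ _ ]) d with decompose L d
... | _ , _ , c , 𝟏E p e f = _ , _ , let⋆ c p e , f

plug : Δ ⨾ Γ ⊢ L ⊣ Δ′ ⨾ Γ′ → Δ′ ⨾ Γ′ ⊢ t ∶ A → Δ ⨾ Γ ⊢ L ⟦ t ⟧ ∶ A
plug □            d = d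
plug (let⊗ c p e) d = plug c (⊗E p e d)
plug (let! c p e) d = plug c (!E p e d)
plug (let⋆ c p e) d = plug c (𝟏E p e d)

-- At each eliminator the extra resources are assigned to the body, so they all reach the hole.
frame : {L : PCtx m n i j} → Δ ⨾ Γ₁ ⊢ L ⊣ Δ′ ⨾ Γ′ → Γ₁ ⊎ Γ₂ ≔ Γ →
        ∃ λ Γ″ → (Δ ⨾ Γ ⊢ L ⊣ Δ′ ⨾ Γ″) × (Γ′ ⊎ push (shiftᵉ j) Γ₂ ≔ Γ″)
frame □ q = _ , □ , q
frame (let⊗ c p e) q =
  let _ , c′ , q′ = frame c q
      _ , r₁ , r₂ = ⊎-assoc p q′
  in _ , let⊗ c′ r₂ e , left (left r₁)
frame (let! c p e) q =
  let _ , c′ , q′ = frame c q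
      _ , r₁ , r₂ = ⊎-assoc p q′
  in _ , let! c′ r₂ e , r₁
frame (let⋆ c p e) q =
  let _ , c′ , q′ = frame c q
      _ , r₁ , r₂ = ⊎-assoc p q′
  in _ , let⋆ c′ r₂ e , r₁

hole-renames : {L : PCtx m n i j} → Δ ⨾ Γ ⊢ L ⊣ Δ′ ⨾ Γ′ → Renames (i ↑ʳ_) Δ Δ′
hole-renames □            u = refl
hole-renames (let⊗ c _ _) u = hole-renames c u
hole-renames (let! c _ _) u = hole-renames c u
hole-renames (let⋆ c _ _) u = hole-renames c u

wk-⊢ : {L : PCtx m n i j} → Δ ⨾ Γ ⊢ L ⊣ Δ′ ⨾ Γ′ → Δ ⨾ Γ₁ ⊢ t ∶ A →
       Δ′ ⨾ push (shiftᵉ j) Γ₁ ⊢ wk i j t ∶ A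
wk-⊢ c = ren-⊢ (shiftᵉ _) (hole-renames c)

renᴾ-⊢ : {ρ : Fin m → Fin m′} {L : PCtx m n i j} (E : Embedding τ) → Renames ρ Δ Δ₁ →
         Δ ⨾ Γ ⊢ L ⊣ Δ′ ⨾ Γ′ →
         ∃ λ Δ₁′ → Renames (lift i ρ) Δ′ Δ₁′ × (Δ₁ ⨾ push E Γ ⊢ renᴾ ρ τ L ⊣ Δ₁′ ⨾ push (liftᵉ j E) Γ′)
renᴾ-⊢ E R □ = _ , R , □
renᴾ-⊢ {j = suc (suc j)} E R (let⊗ c p e) =
  let _ , R′ , c′ = renᴾ-⊢ E R c
  in _ , R′ , let⊗ c′ (push-⊎ (liftᵉ j E) p) (ren-⊢ (liftᵉ j E) R′ e)
renᴾ-⊢ {i = suc i} {j = j} E R (let! c p e) =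
  let _ , R′ , c′ = renᴾ-⊢ E R c
  in _ , (λ { zero → refl ; (suc u) → R′ u }) ,
     let! c′ (push-⊎ (liftᵉ j E) p) (ren-⊢ (liftᵉ j E) R′ e)
renᴾ-⊢ {j = j} E R (let⋆ c p e) =
  let _ , R′ , c′ = renᴾ-⊢ E R c
  in _ , R′ , let⋆ c′ (push-⊎ (liftᵉ j E) p) (ren-⊢ (liftᵉ j E) R′ e)

-- Serves the four axioms for `_♯_` with two contexts. `K` is framed with the resources of `L`, then
-- the weakened `L` with those at the hole of `K`. The last component fills the combined hole.
nest : {L : PCtx m n i j} {K : PCtx m n k l} →
       Δ ⨾ Γ₁ ⊢ L ⊣ Δ₁ ⨾ Γ₃ → Δ ⨾ Γ₂ ⊢ K ⊣ Δ₂ ⨾ Γ₄ → Γ₁ ⊎ Γ₂ ≔ Γ →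
       ∃₂ λ Δ′ Γ′ →
         Renames (lift i (k ↑ʳ_)) Δ₁ Δ′ ×
         Renames (i ↑ʳ_) Δ₂ Δ′ ×
         (push (liftᵉ j (shiftᵉ l)) Γ₃ ⊎ push (shiftᵉ j) Γ₄ ≔ Γ′) ×
         (∀ {t A} → Δ′ ⨾ Γ′ ⊢ t ∶ A → Δ ⨾ Γ ⊢ K ⟦ wkᴾ k l L ⟦ t ⟧ ⟧ ∶ A)
nest {l = l} c d p =
  let _ , d′ , q = frame d (⊎-comm p)
      _ , R , c′ = renᴾ-⊢ (shiftᵉ l) (hole-renames d) c
      _ , c″ , q′ = frame c′ (⊎-comm q)
  in _ , _ , R , hole-renames c′ , q′ , λ e → plug d′ (plug c″ e)

-- Subject reduction

-- `⅋I` concludes with negated formulae, so inversion at an arbitrary `A ⅋ B` needs involutivity.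
⅋I⁻¹ : Δ ⨾ Γ ⊢ ⅋· t ∶ A ⅋ B → Δ ⨾ just (A ^⊥) ∷ just (B ^⊥) ∷ Γ ⊢ t ∶ ⊥
⅋I⁻¹ (⅋I {A = A} {B = B} d) rewrite ^⊥-involutive A | ^⊥-involutive B = d

!I⁻¹ : Δ ⨾ Γ ⊢ !· t ∶ ! A → Γ ≡ ∅ × (Δ ⨾ just (A ^⊥) ∷ ∅ ⊢ t ∶ ⊥)
!I⁻¹ (!I {A = A} d) rewrite ^⊥-involutive A = refl , d

contra-⋆-⊢ : t ⟪ zero ∖∖ ⋆ ⟫≔ r → Δ ⨾ just (A ^⊥) ∷ Γ ⊢ t ∶ ⊥ → Δ ⨾ Γ ⊢ r ∶ A
contra-⋆-⊢ c d = double-dual⁻¹ (contra-⊢ c here d 𝟏I (⊎-identityʳ _))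

↦-⊢ : t ↦ t′ → Δ ⨾ Γ ⊢ t ∶ A → Δ ⨾ Γ ⊢ t′ ∶ A
↦-⊢ (⅋• L h) (⅋E• p d e) with decompose L d
... | _ , _ , c , d′ =
  let _ , c′ , q = frame c p
  in plug c′ (contra-⋆-⊢ h (subₗ-⊢ (⅋I⁻¹ d′)
       (fill here (used (wk-linear-⊢ 1 (wk-⊢ c e))) (left q))))
↦-⊢ (⅋▾ L h) (⅋E▾ p d e) with decompose L d
... | _ , _ , c , d′ =
  let _ , c′ , q = frame c p
  in plug c′ (contra-⋆-⊢ h (subₗ-⊢ (⅋I⁻¹ d′)
       -- Index 1 is replaced; the variable left at index 0 is then contra-substituted.
       (fill (there here) (used (wk-linear-⊢ 1 (wk-⊢ c e))) (left q))))
↦-⊢ (⊗⊗ {j = j} L) (⊗E p d e) with decompose L d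
... | _ , _ , c , ⊗I q d₁ d₂ =
  let _ , c′ , q′ = frame c p
  in plug c′ (sub-pair-⊢ q (⊎-comm q′) (ren-⊢ (liftᵉ 2 (shiftᵉ j)) (hole-renames c) e) d₁ d₂)
↦-⊢ (!! {j = j} L h) (!E p d e) with decompose L d
... | _ , _ , c , d′ with !I⁻¹ d′ | frame c p
-- A box consumes nothing, so the framed hole holds exactly the weakened resources of the body.
... | refl , d″ | _ , c′ , q with refl ← ∅⊎-injective q =
  plug c′ (subᵤ-⊢ (ren-⊢ (shiftᵉ j) (renames-lift (hole-renames c)) e) here (contra-⋆-⊢ h d″))
↦-⊢ (?? {j = j} L h) (?E d e) with decompose L d
... | _ , _ , c , ?I d′ =
  plug c (subᵤ-⊢ d′ here
    (push-∅-⊢⁻¹ (shiftᵉ j) (wk-⊢ c (contra-⊢ h here e 𝟏I (⊎-identityʳ ∅)))))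
↦-⊢ (⅋⊗ {j = j} {l = l} L K) (cut p d e) with decompose L d
... | _ , _ , c , ⅋I d′ with decompose K e
... | _ , _ , c′ , ⊗I q e₁ e₂ =
  let _ , _ , R , R′ , q′ , f = nest c c′ p
  in f (sub-pair-⊢ (push-⊎ (shiftᵉ j) q) q′ (ren-⊢ (liftᵉ (2 + j) (shiftᵉ l)) R d′)
         -- The cut types the pair at `(A ^⊥ ⅋ B ^⊥) ^⊥`, negating each component twice, while the
         -- par binds `A` and `B`.
         (double-dual⁻¹ (ren-⊢ (shiftᵉ j) R′ e₁)) (double-dual⁻¹ (ren-⊢ (shiftᵉ j) R′ e₂)))
↦-⊢ (⊗⅋ {j = j} {l = l} L K) (cut p d e) with decompose L d
... | _ , _ , c , ⊗I q d₁ d₂ with decompose K e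
... | _ , _ , c′ , e′ =
  let _ , _ , R , R′ , q′ , f = nest c c′ p
      E = liftᵉ j (shiftᵉ l)
  in f (sub-pair-⊢ (push-⊎ E q) (⊎-comm q′) (ren-⊢ (liftᵉ 2 (shiftᵉ j)) R′ (⅋I⁻¹ e′))
         (double-dual (ren-⊢ E R d₁)) (double-dual (ren-⊢ E R d₂)))
↦-⊢ (!? {j = j} {l = l} L K h) (cut p d e) with decompose L d
... | _ , _ , c , !I d′ with decompose K e
... | _ , _ , c′ , ?I e′ with nest c c′ p
... | _ , _ , R , R′ , q , f with refl ← push-∅⊎-injective (liftᵉ j (shiftᵉ l)) q =
  f (subᵤ-⊢ (ren-⊢ (shiftᵉ j) (renames-lift R′) e′) here
       (double-dual (push-∅-⊢⁻¹ E (ren-⊢ E R (contra-⊢ h here d′ 𝟏I (⊎-identityʳ ∅))))))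
  where E = liftᵉ j (shiftᵉ l)
↦-⊢ (?! {j = j} {l = l} L K h) (cut p d e) with decompose L d
... | _ , _ , c , ?I d′ with decompose K e
... | _ , _ , c′ , e′ with !I⁻¹ e′ | nest c c′ p
... | refl , e″ | _ , _ , R , R′ , q , f with refl ← push-∅⊎-injective (shiftᵉ j) (⊎-comm q) =
  -- `lift (1 + i)` and `lift 1` of `lift i` agree only pointwise, hence the case split.
  f (subᵤ-⊢ (ren-⊢ (liftᵉ j (shiftᵉ l)) (λ { zero → refl ; (suc u) → R u }) d′) here
       (push-∅-⊢⁻¹ (shiftᵉ j) (ren-⊢ (shiftᵉ j) R′ (contra-⋆-⊢ h e″))))

-- Contextual closure and structural equivalence

⟶⁻-⊢ : t ⟶⁻ t′ → Δ ⨾ Γ ⊢ t ∶ A → Δ ⨾ Γ ⊢ t′ ∶ A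
⟶⁻-⊢ (ax h)    d           = ↦-⊢ h d
⟶⁻-⊢ (pair₁ h) (⊗I p d e)  = ⊗I p (⟶⁻-⊢ h d) e
⟶⁻-⊢ (pair₂ h) (⊗I p d e)  = ⊗I p d (⟶⁻-⊢ h e)
⟶⁻-⊢ (let⊗₁ h) (⊗E p d e)  = ⊗E p d (⟶⁻-⊢ h e)
⟶⁻-⊢ (let⊗₂ h) (⊗E p d e)  = ⊗E p (⟶⁻-⊢ h d) e
⟶⁻-⊢ (par h)   (⅋I d)      = ⅋I (⟶⁻-⊢ h d)
⟶⁻-⊢ (app•₁ h) (⅋E• p d e) = ⅋E• p (⟶⁻-⊢ h d) e
⟶⁻-⊢ (app•₂ h) (⅋E• p d e) = ⅋E• p d (⟶⁻-⊢ h e)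
⟶⁻-⊢ (app▾₁ h) (⅋E▾ p d e) = ⅋E▾ p (⟶⁻-⊢ h d) e
⟶⁻-⊢ (app▾₂ h) (⅋E▾ p d e) = ⅋E▾ p d (⟶⁻-⊢ h e)
⟶⁻-⊢ (bang h)  (!I d)      = !I (⟶⁻-⊢ h d)
⟶⁻-⊢ (let!₁ h) (!E p d e)  = !E p d (⟶⁻-⊢ h e)
⟶⁻-⊢ (let!₂ h) (!E p d e)  = !E p (⟶⁻-⊢ h d) e
⟶⁻-⊢ (whyn h)  (?I d)      = ?I (⟶⁻-⊢ h d)
⟶⁻-⊢ (ask₁ h)  (?E d e)    = ?E d (⟶⁻-⊢ h e)
⟶⁻-⊢ (ask₂ h)  (?E d e)    = ?E (⟶⁻-⊢ h d) e
⟶⁻-⊢ (cut₁ h)  (cut p d e) = cut p (⟶⁻-⊢ h d) e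
⟶⁻-⊢ (cut₂ h)  (cut p d e) = cut p d (⟶⁻-⊢ h e)
⟶⁻-⊢ (let⋆₁ h) (𝟏E p d e)  = 𝟏E p d (⟶⁻-⊢ h e)
⟶⁻-⊢ (let⋆₂ h) (𝟏E p d e)  = 𝟏E p (⟶⁻-⊢ h d) e

∼-⊢ : Δ ⨾ Γ ⊢ t ∼ t′ ∶ A → (Δ ⨾ Γ ⊢ t ∶ A) × (Δ ⨾ Γ ⊢ t′ ∶ A)
∼-⊢ (ax _ d e)    = d , e
∼-⊢ (pair₁ p h e) = let d , d′ = ∼-⊢ h in ⊗I p d e , ⊗I p d′ e
∼-⊢ (pair₂ p d h) = let e , e′ = ∼-⊢ h in ⊗I p d e , ⊗I p d e′
∼-⊢ (let⊗₁ p d h) = let e , e′ = ∼-⊢ h in ⊗E p d e , ⊗E p d e′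
∼-⊢ (let⊗₂ p h e) = let d , d′ = ∼-⊢ h in ⊗E p d e , ⊗E p d′ e
∼-⊢ (par h)       = let d , d′ = ∼-⊢ h in ⅋I d , ⅋I d′
∼-⊢ (app•₁ p h e) = let d , d′ = ∼-⊢ h in ⅋E• p d e , ⅋E• p d′ e
∼-⊢ (app•₂ p d h) = let e , e′ = ∼-⊢ h in ⅋E• p d e , ⅋E• p d e′
∼-⊢ (app▾₁ p h e) = let d , d′ = ∼-⊢ h in ⅋E▾ p d e , ⅋E▾ p d′ e
∼-⊢ (app▾₂ p d h) = let e , e′ = ∼-⊢ h in ⅋E▾ p d e , ⅋E▾ p d e′
∼-⊢ (bang h)      = let d , d′ = ∼-⊢ h in !I d , !I d′
∼-⊢ (let!₁ p d h) = let e , e′ = ∼-⊢ h in !E p d e , !E p d e′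
∼-⊢ (let!₂ p h e) = let d , d′ = ∼-⊢ h in !E p d e , !E p d′ e
∼-⊢ (whyn h)      = let d , d′ = ∼-⊢ h in ?I d , ?I d′
∼-⊢ (ask₁ d h)    = let e , e′ = ∼-⊢ h in ?E d e , ?E d e′
∼-⊢ (ask₂ h e)    = let d , d′ = ∼-⊢ h in ?E d e , ?E d′ e
∼-⊢ (cut₁ p h e)  = let d , d′ = ∼-⊢ h in cut p d e , cut p d′ e
∼-⊢ (cut₂ p d h)  = let e , e′ = ∼-⊢ h in cut p d e , cut p d e′
∼-⊢ (let⋆₁ p d h) = let e , e′ = ∼-⊢ h in 𝟏E p d e , 𝟏E p d e′
∼-⊢ (let⋆₂ p h e) = let d , d′ = ∼-⊢ h in 𝟏E p d e , 𝟏E p d′ e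

-- Each link of the chain carries derivations of both its ends, so the last one types `t′`; the
-- given derivation covers the empty chain.
≋-⊢ : Δ ⨾ Γ ⊢ t ≋ t′ ∶ A → Δ ⨾ Γ ⊢ t ∶ A → Δ ⨾ Γ ⊢ t′ ∶ A
≋-⊢ ε           d = d
≋-⊢ (fwd h ◅ e) _ = ≋-⊢ e (proj₂ (∼-⊢ h))
≋-⊢ (bwd h ◅ e) _ = ≋-⊢ e (proj₁ (∼-⊢ h))

lemma17 : ∀ {X m n} {Δ : UCtx X m} {Γ : LCtx X n} {A : Formula X} {t s : Term m n} →
    Δ ⨾ Γ ⊢ t ∶ A → Δ ⨾ Γ ⊢ t ⟶ s ∶ A → Δ ⨾ Γ ⊢ s ∶ A
lemma17 d (_ , _ , e , h , f) = ≋-⊢ f (⟶⁻-⊢ h (≋-⊢ e d))
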